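{- Let $n,k$ be positive integers and let $p_{n,k}(u)$ be the probability generating polynomial of the length of the longest directed path in an acyclic orientation of the complete bipartite graph $K_{n,k}$ sampled uniformly at random from all acyclic orientations of $K_{n,k}$; that is, the coefficient of $u^\ell$ in $p_{n,k}(u)$ is the probability that the longest directed path has length exactly $\ell$. Let $$F(x,y,u)=\frac{e^{x+y}-(u-1)^2(e^{x}-1)(e^{y}-1)}{1-u^2(e^x-1)(e^y-1)}.$$ Then $$p_{n,k}(u)=\frac{[x^ny^k]F(x,y,u)}{[x^ny^k]F(x,y,1)}.$$
   Context: An acyclic orientation of a graph is an assignment of a direction to each edge such that no directed cycle is formed. The length of a directed path is its number of edges. $K_{n,k}$ is the complete bipartite graph with (labeled) parts of sizes $n$ and $k$. $[x^ny^k]$ denotes extraction of the coefficient of $x^ny^k$ in the power series expansion in $x,y$ about the origin, with $u$ treated as a parameter (so that $[x^ny^k]F(x,y,u)$ is a polynomial in $u$). -}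

module Defs where

open import Algebra.Bundles.Raw using (RawRing)
import Algebra.Definitions.RawMonoid as RawMonoidDefs
import Algebra.Definitions.RawSemiring as RawSemiringDefs
open import Data.Fin.Base using (Fin; toℕ; join; splitAt)
import Data.Fin.Properties as Fin
open import Data.Integer.Base using (+_)
open import Data.List.Base as List using (List; []; _∷_; length; filter; cartesianProductWith; applyUpTo)
open import Data.List.Membership.Propositional using (_∈_)
open import Data.List.Membership.Propositional.Properties using (∈-filter⁺; ∈-cartesianProductWith⁺; ∈-length)
open import Data.List.Properties using (filter-none)
import Data.List.Relation.Unary.All as ListAll
open import Data.List.Relation.Unary.Any using (here)
open import Data.Nat.Base as ℕ using (ℕ; zero; suc; _∸_; _!; _≤_; _<_; >-nonZero)
import Data.Nat.Properties as ℕ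
open import Data.Product.Base using (∃; _×_; _,_; proj₁)
open import Data.Rational.Base as ℚ using (ℚ; 0ℚ; 1ℚ; +-*-rawRing)
import Data.Rational.Properties as ℚ
open import Data.Sum.Base using (_⊎_; inj₁; inj₂)
import Data.Sum.Properties as Sum
open import Data.Vec.Base using (Vec; []; _∷_; lookup; head; last; replicate)
open import Data.Vec.Properties using (lookup-replicate)
open import Data.Vec.Relation.Unary.AllPairs using (allPairs?)
open import Data.Vec.Relation.Unary.Linked using (Linked; _∷_; linked?)
open import Data.Vec.Relation.Unary.Unique.Propositional using (Unique)
open import Data.Vec.Relation.Unary.Unique.Propositional.Properties using (lookup-injective)
open import Function.Base using (id; _∘_)
open import Level using (0ℓ)
import Relation.Binary.Definitions as B
open import Relation.Binary.Core using (Rel)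
open import Relation.Binary.PropositionalEquality using (_≡_; refl; sym; trans; cong)
open import Relation.Nullary using (¬_; Dec; yes; no; ¬?)
open import Relation.Nullary.Decidable using (map′; _×-dec_; _⊎-dec_)
import Relation.Unary as U

module _ {V : Set} (_⟶_ : Rel V 0ℓ) where

  record IsDirectedPath {ℓ} (vs : Vec V (suc ℓ)) : Set where
    constructor isPath
    field
      arcs     : Linked _⟶_ vs
      distinct : Unique vs

  HasPathOfLength : ℕ → Set
  HasPathOfLength ℓ = ∃ λ (vs : Vec V (suc ℓ)) → IsDirectedPath vs

  HasCycle : Set
  HasCycle = ∃ λ ℓ → ∃ λ (vs : Vec V (suc ℓ)) → IsDirectedPath vs × (last vs ⟶ head vs)

  Acyclic : Set
  Acyclic = ¬ HasCycle

  LongestPathHasLength : ℕ → Set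
  LongestPathHasLength ℓ = HasPathOfLength ℓ × (∀ m → HasPathOfLength m → m ≤ ℓ)

Vertex : ℕ → ℕ → Set
Vertex n k = Fin n ⊎ Fin k

data Direction : Set where
  left⇒right right⇒left : Direction

-- Row i, column j holds the direction of the edge {inj₁ i , inj₂ j}.
Orientation : ℕ → ℕ → Set
Orientation n k = Vec (Vec Direction k) n

direction : ∀ {n k} → Orientation n k → Fin n → Fin k → Direction
direction o i j = lookup (lookup o i) j

data Arc {n k} (o : Orientation n k) : Vertex n k → Vertex n k → Set where
  lr : ∀ {i j} → direction o i j ≡ left⇒right → Arc o (inj₁ i) (inj₂ j)
  rl : ∀ {i j} → direction o i j ≡ right⇒left → Arc o (inj₂ j) (inj₁ i)

vectors : ∀ {A : Set} → List A → (m : ℕ) → List (Vec A m)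
vectors as zero    = [] ∷ []
vectors as (suc m) = cartesianProductWith _∷_ as (vectors as m)

orientations : (n k : ℕ) → List (Orientation n k)
orientations n k = vectors (vectors (left⇒right ∷ right⇒left ∷ []) k) n

private
  Searchable : Set → Set₁
  Searchable A = ∀ {P : A → Set} → U.Decidable P → Dec (∃ P)

  searchVertex : ∀ {n k} → Searchable (Vertex n k)
  searchVertex P? = map′
    (λ { (inj₁ (i , p)) → inj₁ i , p ; (inj₂ (j , p)) → inj₂ j , p })
    (λ { (inj₁ i , p) → inj₁ (i , p) ; (inj₂ j , p) → inj₂ (j , p) })
    (Fin.any? (P? ∘ inj₁) ⊎-dec Fin.any? (P? ∘ inj₂))

  searchVec : ∀ {A} → Searchable A → ∀ m → Searchable (Vec A m)
  searchVec s zero    P? = map′ (λ p → [] , p) (λ { ([] , p) → p }) (P? [])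
  searchVec s (suc m) P? = map′
    (λ { (x , xs , p) → x ∷ xs , p }) (λ { (x ∷ xs , p) → x , xs , p })
    (s λ x → searchVec s m λ xs → P? (x ∷ xs))

  searchBelow : ∀ {P : ℕ → Set} b → (∀ m → P m → m < b) → U.Decidable P → Dec (∃ P)
  searchBelow b bnd P? = map′
    (λ { (m , _ , p) → m , p }) (λ { (m , p) → m , bnd m p , p }) (ℕ.anyUpTo? P? b)

  _≟ᵥ_ : ∀ {n k} → B.DecidableEquality (Vertex n k)
  _≟ᵥ_ = Sum.≡-dec Fin._≟_ Fin._≟_

  _≟ᵈ_ : B.DecidableEquality Direction
  left⇒right ≟ᵈ left⇒right = yes refl
  left⇒right ≟ᵈ right⇒left = no λ ()
  right⇒left ≟ᵈ left⇒right = no λ ()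
  right⇒left ≟ᵈ right⇒left = yes refl

  arc? : ∀ {n k} (o : Orientation n k) → B.Decidable (Arc o)
  arc? o (inj₁ i) (inj₁ _) = no λ ()
  arc? o (inj₁ i) (inj₂ j) = map′ lr (λ { (lr e) → e }) (direction o i j ≟ᵈ left⇒right)
  arc? o (inj₂ j) (inj₁ i) = map′ rl (λ { (rl e) → e }) (direction o i j ≟ᵈ right⇒left)
  arc? o (inj₂ j) (inj₂ _) = no λ ()

  join-injective : ∀ {n k} {v w : Vertex n k} → join n k v ≡ join n k w → v ≡ w
  join-injective {n} {k} {v} {w} e =
    trans (sym (Fin.splitAt-join n k v))
      (trans (cong (splitAt n) e) (Fin.splitAt-join n k w))

  module _ {n k} (o : Orientation n k) where

    isPath? : ∀ {ℓ} → U.Decidable (IsDirectedPath (Arc o) {ℓ})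
    isPath? vs = map′ (λ { (a , d) → isPath a d }) (λ { (isPath a d) → a , d })
      (linked? (arc? o) vs ×-dec allPairs? (λ v w → ¬? (v ≟ᵥ w)) vs)

    hasPathOfLength? : U.Decidable (HasPathOfLength (Arc o))
    hasPathOfLength? ℓ = searchVec searchVertex (suc ℓ) isPath?

path-length-< : ∀ {n k} (o : Orientation n k) ℓ → HasPathOfLength (Arc o) ℓ → ℓ < n ℕ.+ k
path-length-< {n} {k} o ℓ (vs , isPath _ distinct) =
  Fin.injective⇒≤ {f = join n k ∘ lookup vs}
    (λ {i} {j} e → lookup-injective distinct i j (join-injective e))

acyclic? : ∀ {n k} → U.Decidable (λ (o : Orientation n k) → Acyclic (Arc o))
acyclic? {n} {k} o = ¬? (searchBelow (n ℕ.+ k)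
  (λ { ℓ (vs , p , _) → path-length-< o ℓ (vs , p) })
  (λ ℓ → searchVec searchVertex (suc ℓ) (λ vs → isPath? o vs ×-dec arc? o (last vs) (head vs))))

longestPathHasLength? : ∀ {n k} ℓ → U.Decidable (λ (o : Orientation n k) → LongestPathHasLength (Arc o) ℓ)
longestPathHasLength? {n} {k} ℓ o = hasPathOfLength? o ℓ ×-dec map′
  (λ ¬∃ m p → ℕ.≮⇒≥ λ ℓ<m → ¬∃ (m , p , ℓ<m))
  (λ max → λ { (m , p , ℓ<m) → ℕ.<⇒≱ ℓ<m (max m p) })
  (¬? (searchBelow (n ℕ.+ k) (λ { m (p , _) → path-length-< o m p })
    (λ m → hasPathOfLength? o m ×-dec (ℓ ℕ.<? m))))

acyclicOrientations : (n k : ℕ) → List (Orientation n k)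
acyclicOrientations n k = filter acyclic? (orientations n k)

private
  ∈-vectors : ∀ {A : Set} {a : A} {as} → a ∈ as → ∀ m → replicate m a ∈ vectors as m
  ∈-vectors a∈ zero    = here refl
  ∈-vectors a∈ (suc m) = ∈-cartesianProductWith⁺ _∷_ a∈ (∈-vectors a∈ m)

  allRight : ∀ n k → Orientation n k
  allRight n k = replicate n (replicate k left⇒right)

  allRight-direction : ∀ n k i j → direction (allRight n k) i j ≡ left⇒right
  allRight-direction n k i j =
    trans (cong (λ r → lookup r j) (lookup-replicate i (replicate k left⇒right)))
          (lookup-replicate j left⇒right)

  allRight-no-two-arcs : ∀ {n k u v w} → Arc (allRight n k) u v → ¬ Arc (allRight n k) v w
  allRight-no-two-arcs {n} {k} (lr _) (rl {i} {j} e)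
    with () ← trans (sym (allRight-direction n k i j)) e
  allRight-no-two-arcs {n} {k} (rl {i} {j} e) _
    with () ← trans (sym (allRight-direction n k i j)) e

  allRight-acyclic : ∀ n k → Acyclic (Arc (allRight n k))
  allRight-acyclic n k (_ , _ ∷ []        , _                       , c) = allRight-no-two-arcs c c
  allRight-acyclic n k (_ , _ ∷ _ ∷ []    , isPath (a ∷ _) _        , c) = allRight-no-two-arcs a c
  allRight-acyclic n k (_ , _ ∷ _ ∷ _ ∷ _ , isPath (a ∷ b ∷ _) _    , _) = allRight-no-two-arcs a b

acyclicOrientations-nonEmpty : ∀ n k → ℕ.NonZero (length (acyclicOrientations n k))
acyclicOrientations-nonEmpty n k = >-nonZero (∈-length
  (∈-filter⁺ acyclic? (∈-vectors (∈-vectors (here refl) k) n) (allRight-acyclic n k)))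

probLongestPath : (n k ℓ : ℕ) → ℚ
probLongestPath n k ℓ =
  (+ length (filter (longestPathHasLength? ℓ) (acyclicOrientations n k))
    ℚ./ length (acyclicOrientations n k)) {{acyclicOrientations-nonEmpty n k}}

-- Coefficients in ℚ, lowest degree first; trailing zeros are allowed, so polynomials
-- are compared by _≈ₚ_.
Poly : Set
Poly = List ℚ

coeff : Poly → ℕ → ℚ
coeff []      _       = 0ℚ
coeff (a ∷ p) zero    = a
coeff (a ∷ p) (suc i) = coeff p i

infix 4 _≈ₚ_
_≈ₚ_ : Rel Poly 0ℓ
p ≈ₚ q = ∀ i → coeff p i ≡ coeff q i

constant : ℚ → Poly
constant a = a ∷ []

var : Poly
var = 0ℚ ∷ 1ℚ ∷ []

infixr 7 _•_
_•_ : ℚ → Poly → Poly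
a • p = List.map (a ℚ.*_) p

_+ₚ_ : Poly → Poly → Poly
[]      +ₚ q       = q
(a ∷ p) +ₚ []      = a ∷ p
(a ∷ p) +ₚ (b ∷ q) = (a ℚ.+ b) ∷ (p +ₚ q)

_*ₚ_ : Poly → Poly → Poly
[]      *ₚ q = []
(a ∷ p) *ₚ q = (a • q) +ₚ (0ℚ ∷ (p *ₚ q))

ℚ[u] : RawRing 0ℓ 0ℓ
ℚ[u] = record
  { Carrier = Poly
  ; _≈_     = _≈ₚ_
  ; _+_     = _+ₚ_
  ; _*_     = _*ₚ_
  ; -_      = List.map (ℚ.-_)
  ; 0#      = []
  ; 1#      = constant 1ℚ
  }

-- Paths in K_{n,k} have length below n + k, so cutting off there loses nothing;
-- see coeff-pgf.
pgf : (n k : ℕ) → Poly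
pgf n k = applyUpTo (probLongestPath n k) (n ℕ.+ k)

private
  coeff-applyUpTo : ∀ (f : ℕ → ℚ) m → (∀ i → m ≤ i → f i ≡ 0ℚ) → ∀ i → coeff (applyUpTo f m) i ≡ f i
  coeff-applyUpTo f zero    f≡0 i       = sym (f≡0 i ℕ.z≤n)
  coeff-applyUpTo f (suc m) f≡0 zero    = refl
  coeff-applyUpTo f (suc m) f≡0 (suc i) = coeff-applyUpTo (f ∘ suc) m (λ j m≤j → f≡0 (suc j) (ℕ.s≤s m≤j)) i

  0/length : ∀ {A : Set} {xs : List A} d .{{_ : ℕ.NonZero d}} → xs ≡ [] → + length xs ℚ./ d ≡ 0ℚ
  0/length d refl = ℚ.0/n≡0 d

  probLongestPath-≥ : ∀ n k ℓ → n ℕ.+ k ≤ ℓ → probLongestPath n k ℓ ≡ 0ℚ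
  probLongestPath-≥ n k ℓ n+k≤ℓ = 0/length _ {{acyclicOrientations-nonEmpty n k}}
    (filter-none (longestPathHasLength? ℓ) {xs = acyclicOrientations n k}
      (ListAll.universal (λ o lp → ℕ.<⇒≱ (path-length-< o ℓ (proj₁ lp)) n+k≤ℓ) _))

coeff-pgf : ∀ n k ℓ → coeff (pgf n k) ℓ ≡ probLongestPath n k ℓ
coeff-pgf n k = coeff-applyUpTo (probLongestPath n k) (n ℕ.+ k) (probLongestPath-≥ n k)

-- Series over R in x and y, f n k being the coefficient of x^n y^k; ι embeds ℚ in R.
module PowerSeries (R : RawRing 0ℓ 0ℓ) (ι : ℚ → RawRing.Carrier R) where

  private
    module R = RawRing R
    open RawMonoidDefs R.+-rawMonoid using (sum)

  Series : Set
  Series = ℕ → ℕ → R.Carrier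

  infix 9 [x^_y^_]_
  [x^_y^_]_ : ℕ → ℕ → Series → R.Carrier
  [x^ n y^ k ] f = f n k

  scalar : R.Carrier → Series
  scalar a zero zero = a
  scalar a _    _    = R.0#

  𝐱 𝐲 : Series
  𝐱 1 0 = R.1#
  𝐱 _ _ = R.0#
  𝐲 0 1 = R.1#
  𝐲 _ _ = R.0#

  Σ≤ : ℕ → (ℕ → R.Carrier) → R.Carrier
  Σ≤ n f = sum {suc n} (f ∘ toℕ)

  seriesRing : RawRing 0ℓ 0ℓ
  seriesRing = record
    { Carrier = Series
    ; _≈_     = λ f g → ∀ n k → f n k R.≈ g n k
    ; _+_     = λ f g n k → f n k R.+ g n k
    ; _*_     = λ f g n k → Σ≤ n λ i → Σ≤ k λ j → f i j R.* g (n ∸ i) (k ∸ j)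
    ; -_      = λ f n k → R.- f n k
    ; 0#      = scalar R.0#
    ; 1#      = scalar R.1#
    }

  open RawRing seriesRing using (_+_; _*_; -_; 1#; rawSemiring)
  open RawSemiringDefs rawSemiring using (_^_)

  infixl 6 _-_
  _-_ : Series → Series → Series
  f - g = f + (- g)

  -- exp f = Σ_m f^m / m!, for f with zero constant term.  Then f^m has no term of
  -- total degree below m, so only m ≤ n + k contribute to the coefficient of x^n y^k.
  exp : Series → Series
  exp f n k = Σ≤ (n ℕ.+ k) λ m → ι ((+ 1 ℚ./ (m !)) {{m ℕ.!≢0}}) R.* (f ^ m) n k

  -- Inverse of a series with constant term 1, by f⁻¹ = Σ_m (1 - f)^m, truncated as in exp.
  infix 8 _⁻¹
  _⁻¹ : Series → Series
  (f ⁻¹) n k = Σ≤ (n ℕ.+ k) λ m → ((1# - f) ^ m) n k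

  infixl 7 _/_
  _/_ : Series → Series → Series
  f / g = f * g ⁻¹

  -- Division is legitimate here: the denominator has constant term 1.
  F : R.Carrier → Series
  F a = (exp (𝐱 + 𝐲) - (u - 1#) ^ 2 * (exp 𝐱 - 1#) * (exp 𝐲 - 1#))
      / (1# - u ^ 2 * (exp 𝐱 - 1#) * (exp 𝐲 - 1#))
    where u = scalar a

module Seriesℚ    = PowerSeries +-*-rawRing id
module Seriesℚ[u] = PowerSeries ℚ[u] constant

coeffF : (n k : ℕ) → Poly
coeffF n k = [x^ n y^ k ] F var
  where open Seriesℚ[u]

coeffF₁ : (n k : ℕ) → ℚ
coeffF₁ n k = [x^ n y^ k ] F 1ℚ
  where open Seriesℚ

{-# OPTIONS --safe #-}

-- In an acyclic orientation of K_{n,k} let the level of a vertex be the length of the longest path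
-- starting there.  Vertices of equal level lie on the same side and an arc joins any two vertices of
-- consecutive levels, so the sides alternate with the level and the orientation is recovered from the
-- levels.  Orientations with longest path ℓ thus correspond to pairs of surjections of the two parts
-- onto the even and the odd numbers among 0, …, ℓ, in either order.
--
-- On the other side, with X = eˣ - 1 and Y = eʸ - 1 the numerator of F is
-- (1 - u²XY) + X + Y + 2uXY, so F = 1 + Σₘ u²ᵐ (Xᵐ⁺¹Yᵐ + XᵐYᵐ⁺¹ + 2u Xᵐ⁺¹Yᵐ⁺¹),
-- and n! [xⁿ] Xᵐ is the number of surjections from n points onto m points.
module Submission where

open import Defs
open import Algebra.Bundles using (CommutativeRing; RawRing)
import Algebra.Construct.Pointwise as Pointwise
import Algebra.Definitions.RawSemiring as RawSemiringDefs
import Algebra.Morphism.Construct.Identity as Identity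
import Algebra.Morphism.RingMonomorphism as RingMonomorphism
open import Algebra.Morphism.Structures using (IsRingHomomorphism; IsRingMonomorphism)
import Algebra.Properties.CommutativeSemiring.Exp as CommutativeSemiringExp
import Algebra.Properties.Ring as RingProperties
import Algebra.Properties.Semiring.Exp as SemiringExp
import Algebra.Properties.Semiring.Mult as SemiringMult
import Algebra.Properties.Semiring.Sum as SemiringSum
import Algebra.Solver.Ring.NaturalCoefficients.Default as SemiringSolver
open import Algebra.Structures using (IsCommutativeRing)
open import Data.Empty using (⊥)
open import Data.Fin.Base as Fin using (Fin; zero; suc; toℕ; fromℕ<; punchIn; punchOut)
import Data.Fin.Properties as Fin
open import Data.Integer.Base as ℤ using (+_)
import Data.Integer.Properties as ℤ
open import Data.List.Base as List using (List; []; _∷_; length; filter; applyUpTo)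
open import Data.List.Membership.Propositional using (_∈_)
open import Data.List.Membership.Propositional.Properties using (∈-filter⁺; ∈-filter⁻; ∈-cartesianProductWith⁺; ∈-lookup)
import Data.List.Relation.Unary.All as ListAll
open import Data.List.Relation.Unary.AllPairs using ([]; _∷_)
open import Data.List.Relation.Unary.Any as Any using (here; there)
open import Data.List.Relation.Unary.Any.Properties using (lookup-index)
open import Data.List.Relation.Unary.Unique.Propositional using (Unique)
import Data.List.Relation.Unary.Unique.Propositional.Properties as Unique
open import Data.Nat.Base as ℕ using (ℕ; zero; suc; NonZero; _!; _∸_; _≤_; _<_; z≤n; s≤s; ⌊_/2⌋; ⌈_/2⌉)
import Data.Nat.ListAction as ℕ
import Data.Nat.Properties as ℕ
open import Data.Nat.Solver using (module +-*-Solver)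
open import Data.Product.Base using (Σ-syntax; ∃; _×_; _,_; proj₁; proj₂)
open import Data.Product.Function.NonDependent.Propositional using (_×-↔_)
open import Data.Rational.Base as ℚ using (ℚ; 0ℚ; 1ℚ; toℚᵘ)
import Data.Rational.Properties as ℚ
open import Data.Rational.Unnormalised.Base as ℚᵘ using (mkℚᵘ; *≡*; _≃_)
import Data.Rational.Unnormalised.Properties as ℚᵘ
open import Data.Sum.Base using (_⊎_; inj₁; inj₂)
open import Data.Sum.Function.Propositional using (_⊎-↔_)
open import Data.Unit.Base using (⊤; tt)
open import Data.Vec.Base as Vec using (Vec; []; _∷_; lookup; head; last; tabulate)
import Data.Vec.Properties as Vec
import Data.Vec.Relation.Unary.All as VecAll
open VecAll using ([]; _∷_)
import Data.Vec.Relation.Unary.All.Properties as VecAll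
open import Data.Vec.Relation.Unary.AllPairs using ([]; _∷_)
open import Data.Vec.Relation.Unary.Linked using (Linked; [-]; _∷_)
import Data.Vec.Relation.Unary.Unique.Propositional as Vec
open import Function.Base using (_∘_; id)
open import Function.Bundles using (_↔_; Inverse; mk↔ₛ′)
open import Function.Construct.Composition using (_↔-∘_)
open import Function.Construct.Identity using (↔-id)
open import Function.Construct.Symmetry using (↔-sym)
open import Level using (0ℓ)
open import Relation.Binary.Core using (Rel)
open import Relation.Binary.PropositionalEquality as ≡ using (_≡_; _≢_; _≗_)
import Relation.Binary.Reasoning.Setoid as ≈-Reasoning
open import Relation.Nullary using (¬_; Dec; yes; no; contradiction)
open import Relation.Nullary.Decidable using (map′; _×-dec_; _⊎-dec_)
import Relation.Unary as Unary

-- Power series in one variable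

-- Both halves of the argument meet in the numbers `surjections n m`, given by a recurrence that
-- each half can follow: with the weight 1/n! it becomes the differential equation of the powers of
-- eˣ - 1, and read as a type it becomes a code for actual surjections. Exponentials and inverses
-- are sums truncated at a bound that varies with the coefficient, so no infinite expansion of F is
-- at hand. A finite geometric sum with its remainder takes its place, and the remainder drops out
-- because (u²XY)ᵐ has no term of x-degree below m. The coefficients of F are needed in ℚ[u] and,
-- for u = 1, in ℚ; the calculation therefore runs over a general commutative ring. The factor 1/(n!
-- k!) between coefficients and counts is common to numerator and denominator and cancels. Levels
-- are characterised by local properties, so that the levels of an orientation and those built from
-- a pair of surjections can be compared without speaking of paths.

module Convolution (R : CommutativeRing 0ℓ 0ℓ) where
  open CommutativeRing R
  open SemiringSum semiring
  open ≈-Reasoning setoid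
  open SemiringSolver commutativeSemiring using (solve; _:=_; _:+_; _:*_; con)

  infix 4 _≋_
  _≋_ : (ℕ → Carrier) → (ℕ → Carrier) → Set
  f ≋ g = ∀ n → f n ≈ g n

  infixl 7 _⊛_
  infixl 6 _⊞_
  infixr 8 _∙_
  _⊞_ : (f g : ℕ → Carrier) → ℕ → Carrier
  (f ⊞ g) n = f n + g n

  _∙_ : Carrier → (ℕ → Carrier) → ℕ → Carrier
  (a ∙ f) n = a * f n

  -- At `suc n` this reduces to `f 0 * g (suc n) + (tail f ⊛ g) n`. The inductions below rest on
  -- that unfolding, which replaces f by `tail f` and leaves g alone.
  _⊛_ : (f g : ℕ → Carrier) → ℕ → Carrier
  (f ⊛ g) n = sum {suc n} λ i → f (toℕ i) * g (n ∸ toℕ i)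

  𝟙 : ℕ → Carrier
  𝟙 zero    = 1#
  𝟙 (suc _) = 0#

  tail : (ℕ → Carrier) → ℕ → Carrier
  tail f n = f (suc n)

  ⊛-cong : ∀ {f f′ g g′} → f ≋ f′ → g ≋ g′ → f ⊛ g ≋ f′ ⊛ g′
  ⊛-cong p q n = sum-cong-≋ {suc n} λ i → *-cong (p (toℕ i)) (q (n ∸ toℕ i))

  ⊛-congˡ : ∀ f {g g′} → g ≋ g′ → f ⊛ g ≋ f ⊛ g′
  ⊛-congˡ f = ⊛-cong {f} {f} (λ _ → refl)

  ⊛-congʳ : ∀ g {f f′} → f ≋ f′ → f ⊛ g ≋ f′ ⊛ g
  ⊛-congʳ g p = ⊛-cong {g = g} {g} p (λ _ → refl)

  ⊛-distribʳ : ∀ h f g → (f ⊞ g) ⊛ h ≋ f ⊛ h ⊞ g ⊛ h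
  ⊛-distribʳ h f g zero    = solve 3 (λ f g h → (f :+ g) :* h :+ con 0 := (f :* h :+ con 0) :+ (g :* h :+ con 0))
       refl (f 0) (g 0) (h 0)
  ⊛-distribʳ h f g (suc n) = trans (+-congˡ (⊛-distribʳ h (tail f) (tail g) n))
    (solve 5 (λ f g h a b → (f :+ g) :* h :+ (a :+ b) := (f :* h :+ a) :+ (g :* h :+ b)) refl
      (f 0) (g 0) (h (suc n)) ((tail f ⊛ h) n) ((tail g ⊛ h) n))

  ∙-⊛ : ∀ a f g → (a ∙ f) ⊛ g ≋ a ∙ (f ⊛ g)
  ∙-⊛ a f g zero    = solve 3 (λ a f g → a :* f :* g :+ con 0 := a :* (f :* g :+ con 0)) refl a (f 0) (g 0)
  ∙-⊛ a f g (suc n) = trans (+-congˡ (∙-⊛ a (tail f) g n))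
    (solve 4 (λ a f g c → a :* f :* g :+ a :* c := a :* (f :* g :+ c)) refl a (f 0) (g (suc n)) ((tail f ⊛ g) n))

  -- The mirror image of the defining unfolding: the summand containing `g 0` is split off instead
  -- of the one containing `f 0`. Together the two give commutativity.
  tail-⊛ : ∀ f g → tail (f ⊛ g) ≋ f ⊛ tail g ⊞ g 0 ∙ tail f
  tail-⊛ f g zero    = solve 4 (λ a b c d → a :* b :+ (c :* d :+ con 0) := a :* b :+ con 0 :+ d :* c)
       refl (f 0) (g 1) (f 1) (g 0)
  tail-⊛ f g (suc n) = trans (+-congˡ (tail-⊛ (tail f) g n)) (sym (+-assoc _ _ _))

  ⊛-comm : ∀ f g → f ⊛ g ≋ g ⊛ f
  ⊛-comm f g zero    = +-congʳ (*-comm _ _)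
  ⊛-comm f g (suc n) = begin
    (f ⊛ g) (suc n)                      ≈⟨ tail-⊛ f g n ⟩
    (f ⊛ tail g) n + g 0 * f (suc n)     ≈⟨ +-comm _ _ ⟩
    g 0 * f (suc n) + (f ⊛ tail g) n     ≈⟨ +-congˡ (⊛-comm f (tail g) n) ⟩
    (g ⊛ f) (suc n)                      ∎

  ⊛-assoc : ∀ f g h → (f ⊛ g) ⊛ h ≋ f ⊛ (g ⊛ h)
  ⊛-assoc f g h zero    = solve 3 (λ f g h → (f :* g :+ con 0) :* h :+ con 0 := f :* (g :* h :+ con 0) :+ con 0)
       refl (f 0) (g 0) (h 0)
  ⊛-assoc f g h (suc n) = begin
    (f 0 * g 0 + 0#) * h (suc n) + ((f 0 ∙ tail g ⊞ tail f ⊛ g) ⊛ h) n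
      ≈⟨ +-cong (*-congʳ (+-identityʳ _)) (⊛-distribʳ h (f 0 ∙ tail g) (tail f ⊛ g) n) ⟩
    f 0 * g 0 * h (suc n) + (((f 0 ∙ tail g) ⊛ h) n + ((tail f ⊛ g) ⊛ h) n)
      ≈⟨ +-congˡ (+-cong (∙-⊛ (f 0) (tail g) h n) (⊛-assoc (tail f) g h n)) ⟩
    f 0 * g 0 * h (suc n) + (f 0 * (tail g ⊛ h) n + (tail f ⊛ (g ⊛ h)) n)
      ≈⟨ solve 5 (λ a b c d e → a :* b :* c :+ (a :* d :+ e) := a :* (b :* c :+ d) :+ e) refl
           (f 0) (g 0) (h (suc n)) ((tail g ⊛ h) n) ((tail f ⊛ (g ⊛ h)) n) ⟩
    (f ⊛ (g ⊛ h)) (suc n) ∎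

  𝟘-⊛ : ∀ g → (λ _ → 0#) ⊛ g ≋ λ _ → 0#
  𝟘-⊛ g zero    = trans (+-identityʳ _) (zeroˡ _)
  𝟘-⊛ g (suc n) = trans (+-cong (zeroˡ _) (𝟘-⊛ g n)) (+-identityˡ _)

  ⊛-identityˡ : ∀ f → 𝟙 ⊛ f ≋ f
  ⊛-identityˡ f zero    = trans (+-identityʳ _) (*-identityˡ _)
  ⊛-identityˡ f (suc n) = trans (+-cong (*-identityˡ _) (𝟘-⊛ f n)) (+-identityʳ _)

  -- Over ℚ this ring receives the polynomials in u; applied to its own result it gives the series
  -- in x whose coefficients are series in y.
  ⊛-ring : CommutativeRing 0ℓ 0ℓ
  ⊛-ring = record
    { Carrier = ℕ → Carrier
    ; _≈_ = _≋_
    ; _+_ = _⊞_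
    ; _*_ = _⊛_
    ; -_  = λ f n → - f n
    ; 0#  = λ _ → 0#
    ; 1#  = 𝟙
    ; isCommutativeRing = record
      { isRing = record
        { +-isAbelianGroup = Pointwise.isAbelianGroup ℕ +-isAbelianGroup
        ; *-cong     = ⊛-cong
        ; *-assoc    = ⊛-assoc
        ; *-identity = ⊛-identityˡ , λ f n → trans (⊛-comm f 𝟙 n) (⊛-identityˡ f n)
        ; distrib    = (λ f g h n → trans (⊛-comm f (g ⊞ h) n)
                          (trans (⊛-distribʳ f g h n) (+-cong (⊛-comm g f n) (⊛-comm h f n))))
                       , ⊛-distribʳ
        }
      ; *-comm = ⊛-comm
      }
    }

  open SemiringMult semiring using () renaming (_×_ to _·_)

  fromℕ : ℕ → Carrier
  fromℕ n = n · 1#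

  ∂ : (ℕ → Carrier) → ℕ → Carrier
  ∂ f n = fromℕ (suc n) * f (suc n)

  -- The offset c makes the statement stable under f ↦ tail f.
  euler-⊛ : ∀ c f g n → ((λ i → (c + fromℕ i) * f i) ⊛ g) n + (f ⊛ (λ j → fromℕ j * g j)) n
                       ≈ (c + fromℕ n) * (f ⊛ g) n
  euler-⊛ c f g zero    = solve 3 (λ c f g → ((c :+ con 0) :* f :* g :+ con 0) :+ (f :* (con 0 :* g) :+ con 0)
                                            := (c :+ con 0) :* (f :* g :+ con 0)) refl c (f 0) (g 0)
  euler-⊛ c f g (suc n) = begin
    ((c + 0#) * f 0 * g (suc n) + (f₁ ⊛ g) n) + (f 0 * (fromℕ (suc n) * g (suc n)) + (tail f ⊛ g₁) n)
      ≈⟨ +-congʳ (+-congˡ (⊛-congʳ g {f₁} {f₂} (λ i → *-congʳ (sym (+-assoc c 1# (fromℕ i)))) n)) ⟩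
    ((c + 0#) * f 0 * g (suc n) + (f₂ ⊛ g) n) + (f 0 * (fromℕ (suc n) * g (suc n)) + (tail f ⊛ g₁) n)
      ≈⟨ solve 6 (λ c f g x y n → ((c :+ con 0) :* f :* g :+ x) :+ (f :* (n :* g) :+ y)
                                 := (c :+ n) :* (f :* g) :+ (x :+ y)) refl
           c (f 0) (g (suc n)) ((f₂ ⊛ g) n) ((tail f ⊛ g₁) n) (fromℕ (suc n)) ⟩
    (c + fromℕ (suc n)) * (f 0 * g (suc n)) + ((f₂ ⊛ g) n + (tail f ⊛ g₁) n)
      ≈⟨ +-congˡ (trans (euler-⊛ (c + 1#) (tail f) g n) (*-congʳ (+-assoc c 1# (fromℕ n)))) ⟩
    (c + fromℕ (suc n)) * (f 0 * g (suc n)) + (c + fromℕ (suc n)) * (tail f ⊛ g) n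
      ≈⟨ distribˡ _ _ _ ⟨
    (c + fromℕ (suc n)) * (f ⊛ g) (suc n) ∎
    where
    f₁ f₂ g₁ : ℕ → Carrier
    f₁ i = (c + fromℕ (suc i)) * f (suc i)
    f₂ i = ((c + 1#) + fromℕ i) * f (suc i)
    g₁ j = fromℕ j * g j

  -- By `euler-⊛` with offset 0, multiplying the coefficient of index n by n is a derivation.
  -- Reading it one index higher turns this operator into `∂`, and the boundary terms carry the
  -- weight 0.
  leibniz : ∀ f g → ∂ (f ⊛ g) ≋ ∂ f ⊛ g ⊞ f ⊛ ∂ g
  leibniz f g n = begin
    fromℕ (suc n) * (f ⊛ g) (suc n)
      ≈⟨ *-congʳ (+-identityˡ _) ⟨
    (0# + fromℕ (suc n)) * (f ⊛ g) (suc n)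
      ≈⟨ euler-⊛ 0# f g (suc n) ⟨
    ((λ i → (0# + fromℕ i) * f i) ⊛ g) (suc n) + (f ⊛ θg) (suc n)
      ≈⟨ +-cong (⊛-congʳ g {λ i → (0# + fromℕ i) * f i} {λ i → fromℕ i * f i} (λ i → *-congʳ (+-identityˡ _)) (suc n)) (tail-⊛ f θg n) ⟩
    (0# * f 0 * g (suc n) + (∂ f ⊛ g) n) + ((f ⊛ ∂ g) n + 0# * g 0 * f (suc n))
      ≈⟨ solve 6 (λ f g x y g₀ f₁ → (con 0 :* f :* g :+ x) :+ (y :+ con 0 :* g₀ :* f₁) := x :+ y) refl
           (f 0) (g (suc n)) ((∂ f ⊛ g) n) ((f ⊛ ∂ g) n) (g 0) (f (suc n)) ⟩
    (∂ f ⊛ g) n + (f ⊛ ∂ g) n ∎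
    where
    θg : ℕ → Carrier
    θg j = fromℕ j * g j

  constant-⊛ : ∀ {c} → (∀ i → c (suc i) ≈ 0#) → ∀ f → c ⊛ f ≋ c 0 ∙ f
  constant-⊛ c≈0 f zero    = +-identityʳ _
  constant-⊛ c≈0 f (suc n) = trans (+-congˡ (trans (⊛-congʳ f c≈0 n) (𝟘-⊛ f n))) (+-identityʳ _)

  shift-⊛-zero : ∀ {x} → x 0 ≈ 0# → ∀ f → (x ⊛ f) 0 ≈ 0#
  shift-⊛-zero x₀≈0 f = trans (+-identityʳ _) (trans (*-congʳ x₀≈0) (zeroˡ _))

  shift-⊛-suc : ∀ {x} → x 0 ≈ 0# → tail x ≋ 𝟙 → ∀ f n → (x ⊛ f) (suc n) ≈ f n
  shift-⊛-suc x₀≈0 x₊≈1 f n = trans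
    (+-cong (trans (*-congʳ x₀≈0) (zeroˡ _)) (trans (⊛-congʳ f x₊≈1 n) (⊛-identityˡ f n)))
    (+-identityˡ _)

module ℚ⊛ = Convolution ℚ.+-*-commutativeRing
open ℚ⊛ using (fromℕ)
open SemiringMult (CommutativeRing.semiring ℚ.+-*-commutativeRing) using (×1-homo-*; ×-homo-+)
module ℚSolver = SemiringSolver (CommutativeRing.commutativeSemiring ℚ.+-*-commutativeRing)

-- Surjection numbers and the powers of eˣ - 1

module SurjectionNumbers where
  open ≡ using (refl; sym; trans; cong; cong₂; module ≡-Reasoning)
  open import Data.Rational.Base using (_+_; _*_)
  open ℚ⊛ using (_≋_; _⊛_; _⊞_; _∙_; 𝟙; ∂; leibniz; ⊛-congˡ; ⊛-congʳ; ⊛-distribʳ; ⊛-identityˡ; ⊛-comm; 𝟘-⊛; ∙-⊛)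
  open ℚSolver using (solve; _:=_; _:+_; _:*_; con)

  -- These are m! times the Stirling numbers of the second kind. In the last clause the factor
  -- `suc m` chooses the value of the first point, and the sum asks whether the other points avoid
  -- that value or still cover everything.
  surjections : ℕ → ℕ → ℕ
  surjections zero    zero    = 1
  surjections zero    (suc m) = 0
  surjections (suc n) zero    = 0
  surjections (suc n) (suc m) = suc m ℕ.* (surjections n m ℕ.+ surjections n (suc m))

  toℚᵘ-fromℕ : ∀ n → toℚᵘ (fromℕ n) ≃ mkℚᵘ (+ n) 0
  toℚᵘ-fromℕ zero    = ℚᵘ.≃-refl
  toℚᵘ-fromℕ (suc n) = ℚᵘ.≃-trans (ℚ.toℚᵘ-homo-+ 1ℚ (fromℕ n))
    (ℚᵘ.≃-trans (ℚᵘ.+-congʳ (toℚᵘ 1ℚ) (toℚᵘ-fromℕ n))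
      (*≡* (cong (λ z → (+ 1 ℤ.+ z) ℤ.* + 1) (ℤ.*-identityʳ (+ n)))))

  -- Checked on unnormalised fractions, where it is a cross multiplication of integers and no
  -- greatest common divisor intervenes.
  /-fromℕ : ∀ a b .{{_ : ℕ.NonZero b}} → (+ a ℚ./ b) * fromℕ b ≡ fromℕ a
  /-fromℕ a (suc b) = ℚ.toℚᵘ-injective
    (ℚᵘ.≃-trans (ℚ.toℚᵘ-homo-* (+ a ℚ./ suc b) (fromℕ (suc b)))
    (ℚᵘ.≃-trans (ℚᵘ.*-cong (ℚ.toℚᵘ-fromℚᵘ (mkℚᵘ (+ a) b)) (toℚᵘ-fromℕ (suc b)))
    (ℚᵘ.≃-trans (*≡* (trans (ℤ.*-identityʳ _) (cong (+ a ℤ.*_) (sym (ℤ.*-identityʳ (+ suc b))))))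
    (ℚᵘ.≃-sym (toℚᵘ-fromℕ a)))))

  fromℕ-cancelˡ : ∀ b .{{_ : ℕ.NonZero b}} {p q} → fromℕ b * p ≡ fromℕ b * q → p ≡ q
  fromℕ-cancelˡ b {p} {q} eq = begin
    p                       ≡⟨ unit p ⟨
    b⁻¹ * (fromℕ b * p)     ≡⟨ cong (b⁻¹ *_) eq ⟩
    b⁻¹ * (fromℕ b * q)     ≡⟨ unit q ⟩
    q                       ∎
    where
    open ≡-Reasoning
    b⁻¹ = + 1 ℚ./ b
    unit : ∀ r → b⁻¹ * (fromℕ b * r) ≡ r
    unit r = trans (sym (ℚ.*-assoc b⁻¹ (fromℕ b) r)) (trans (cong (_* r) (/-fromℕ 1 b)) (ℚ.*-identityˡ r))

  1/_! : ℕ → ℚ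
  1/ n ! = (+ 1 ℚ./ (n !)) {{n ℕ.!≢0}}

  1/!-suc : ∀ n → fromℕ (suc n) * 1/ suc n ! ≡ 1/ n !
  1/!-suc n = fromℕ-cancelˡ (n !) {{n ℕ.!≢0}} (begin
    fromℕ (n !) * (fromℕ (suc n) * j)
      ≡⟨ solve 3 (λ a b c → a :* (b :* c) := c :* (b :* a)) refl (fromℕ (n !)) (fromℕ (suc n)) j ⟩
    j * (fromℕ (suc n) * fromℕ (n !))    ≡⟨ cong (j *_) (×1-homo-* (suc n) (n !)) ⟨
    j * fromℕ (suc n !)                  ≡⟨ /-fromℕ 1 (suc n !) {{suc n ℕ.!≢0}} ⟩
    fromℕ 1                              ≡⟨ /-fromℕ 1 (n !) {{n ℕ.!≢0}} ⟨
    1/ n ! * fromℕ (n !)                 ≡⟨ ℚ.*-comm (1/ n !) _ ⟩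
    fromℕ (n !) * 1/ n !                 ∎)
    where
    open ≡-Reasoning
    j = 1/ suc n !

  surjectionSeries : ℕ → ℕ → ℚ
  surjectionSeries m n = fromℕ (surjections n m) * 1/ n !

  expSeries-1 : ℕ → ℚ
  expSeries-1 zero    = 0ℚ
  expSeries-1 (suc n) = 1/ suc n !

  -- The recurrence of `surjections` in exponential form: `∂` shifts the index by one and turns
  -- 1/(n+1)! into 1/n!.
  ∂-surjectionSeries : ∀ m → ∂ (surjectionSeries (suc m)) ≋
                       fromℕ (suc m) ∙ (surjectionSeries m ⊞ surjectionSeries (suc m))
  ∂-surjectionSeries m n = begin
    fromℕ (suc n) * (fromℕ (suc m ℕ.* (a ℕ.+ b)) * 1/ suc n !)
      ≡⟨ cong (λ z → fromℕ (suc n) * (z * 1/ suc n !)) (trans (×1-homo-* (suc m) (a ℕ.+ b)) (cong (fromℕ (suc m) *_) (×-homo-+ 1ℚ a b))) ⟩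
    fromℕ (suc n) * (fromℕ (suc m) * (fromℕ a + fromℕ b) * 1/ suc n !)
      ≡⟨ solve 5 (λ n m a b x → n :* (m :* (a :+ b) :* x) := m :* (a :* (n :* x) :+ b :* (n :* x))) refl
           (fromℕ (suc n)) (fromℕ (suc m)) (fromℕ a) (fromℕ b) (1/ suc n !) ⟩
    fromℕ (suc m) * (fromℕ a * (fromℕ (suc n) * 1/ suc n !) + fromℕ b * (fromℕ (suc n) * 1/ suc n !))
      ≡⟨ cong (λ z → fromℕ (suc m) * (fromℕ a * z + fromℕ b * z)) (1/!-suc n) ⟩
    fromℕ (suc m) * (fromℕ a * 1/ n ! + fromℕ b * 1/ n !) ∎
    where
    open ≡-Reasoning
    a = surjections n m
    b = surjections n (suc m)

  surjectionSeries-zero : surjectionSeries 0 ≋ 𝟙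
  surjectionSeries-zero zero    = refl
  surjectionSeries-zero (suc n) = ℚ.*-zeroˡ (1/ suc n !)

  ∂-expSeries-1 : ∂ expSeries-1 ≋ 𝟙 ⊞ expSeries-1
  ∂-expSeries-1 zero    = refl
  ∂-expSeries-1 (suc n) = trans (1/!-suc (suc n)) (sym (ℚ.+-identityˡ (1/ suc n !)))

  -- For sₘ = Xᵐ and X′ = 1 + X the left side is X · mXᵐ⁻¹(1 + X) = m(Xᵐ + Xᵐ⁺¹). That sₘ is this
  -- power is what is being proved, so three lemmas are mutually recursive: this one at m + 1 uses
  -- `surjectionSeries-suc` at m, which uses `∂-product` at m, which uses this one at m.
  -- `surjectionSeries-suc` itself descends in the coefficient index.
  ∂-expSeries-1-⊛ : ∀ m → expSeries-1 ⊛ ∂ (surjectionSeries m) ≋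
    fromℕ m ∙ (surjectionSeries m ⊞ expSeries-1 ⊛ surjectionSeries m)

  surjectionSeries-suc : ∀ m → expSeries-1 ⊛ surjectionSeries m ≋ surjectionSeries (suc m)

  ∂-product : ∀ m → ∂ (expSeries-1 ⊛ surjectionSeries m) ≋
    fromℕ (suc m) ∙ (surjectionSeries m ⊞ expSeries-1 ⊛ surjectionSeries m)
  ∂-product m n = begin
    ∂ (X ⊛ s) n                                     ≡⟨ leibniz X s n ⟩
    (∂ X ⊛ s) n + (X ⊛ ∂ s) n
      ≡⟨ cong₂ _+_ (⊛-congʳ s ∂-expSeries-1 n) (∂-expSeries-1-⊛ m n) ⟩
    ((𝟙 ⊞ X) ⊛ s) n + fromℕ m * (s n + (X ⊛ s) n)
      ≡⟨ cong (_+ fromℕ m * (s n + (X ⊛ s) n)) (trans (⊛-distribʳ s 𝟙 X n) (cong (_+ (X ⊛ s) n) (⊛-identityˡ s n))) ⟩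
    (s n + (X ⊛ s) n) + fromℕ m * (s n + (X ⊛ s) n)
      ≡⟨ solve 2 (λ t m → t :+ m :* t := (con 1 :+ m) :* t) refl (s n + (X ⊛ s) n) (fromℕ m) ⟩
    fromℕ (suc m) * (s n + (X ⊛ s) n)               ∎
    where
    open ≡-Reasoning
    X = expSeries-1
    s = surjectionSeries m

  ∂-expSeries-1-⊛ zero n = begin
    (expSeries-1 ⊛ ∂ (surjectionSeries 0)) n
      ≡⟨ ⊛-congˡ expSeries-1 (λ i → trans (cong (fromℕ (suc i) *_) (surjectionSeries-zero (suc i))) (ℚ.*-zeroʳ (fromℕ (suc i)))) n ⟩
    (expSeries-1 ⊛ (λ _ → 0ℚ)) n ≡⟨ ⊛-comm expSeries-1 (λ _ → 0ℚ) n ⟩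
    ((λ _ → 0ℚ) ⊛ expSeries-1) n ≡⟨ 𝟘-⊛ expSeries-1 n ⟩
    0ℚ                           ≡⟨ ℚ.*-zeroˡ t ⟨
    0ℚ * t                       ∎
    where
    open ≡-Reasoning
    t = surjectionSeries 0 n + (expSeries-1 ⊛ surjectionSeries 0) n
  ∂-expSeries-1-⊛ (suc m) n = begin
    (X ⊛ ∂ s′) n                         ≡⟨ ⊛-congˡ X (∂-surjectionSeries m) n ⟩
    (X ⊛ c ∙ (s ⊞ s′)) n                 ≡⟨ ⊛-comm X (c ∙ (s ⊞ s′)) n ⟩
    (c ∙ (s ⊞ s′) ⊛ X) n                 ≡⟨ ∙-⊛ c (s ⊞ s′) X n ⟩
    c * ((s ⊞ s′) ⊛ X) n                 ≡⟨ cong (c *_) (⊛-distribʳ X s s′ n) ⟩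
    c * ((s ⊛ X) n + (s′ ⊛ X) n)
      ≡⟨ cong (c *_) (cong₂ _+_ (trans (⊛-comm s X n) (surjectionSeries-suc m n)) (⊛-comm s′ X n)) ⟩
    c * (s′ n + (X ⊛ s′) n)              ∎
    where
    open ≡-Reasoning
    c = fromℕ (suc m)
    X = expSeries-1
    s = surjectionSeries m
    s′ = surjectionSeries (suc m)

  -- Both sides vanish at 0 and solve f′ = (m + 1) (sₘ + f).
  surjectionSeries-suc m zero = begin
    0ℚ * surjectionSeries m 0 + 0ℚ ≡⟨ cong (_+ 0ℚ) (ℚ.*-zeroˡ (surjectionSeries m 0)) ⟩
    0ℚ                             ≡⟨ ℚ.*-zeroˡ (1/ 0 !) ⟨
    surjectionSeries (suc m) 0     ∎
    where open ≡-Reasoning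
  surjectionSeries-suc m (suc n) = fromℕ-cancelˡ (suc n) (begin
    ∂ (expSeries-1 ⊛ s) n                       ≡⟨ ∂-product m n ⟩
    fromℕ (suc m) * (s n + (expSeries-1 ⊛ s) n)
      ≡⟨ cong (λ z → fromℕ (suc m) * (s n + z)) (surjectionSeries-suc m n) ⟩
    fromℕ (suc m) * (s n + s′ n)                ≡⟨ ∂-surjectionSeries m n ⟨
    ∂ s′ n                                      ∎)
    where
    open ≡-Reasoning
    s = surjectionSeries m
    s′ = surjectionSeries (suc m)

open SurjectionNumbers

-- Among 0, ..., ℓ there are ⌊ℓ/2⌋ + 1 even and ⌈ℓ/2⌉ odd numbers. The first summand puts the even
-- levels on the part of size n, the second on the part of size k.
pathCount : (n k ℓ : ℕ) → ℕ
pathCount n k ℓ = surjections n (suc ⌊ ℓ /2⌋) ℕ.* surjections k ⌈ ℓ /2⌉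
            ℕ.+ surjections n ⌈ ℓ /2⌉ ℕ.* surjections k (suc ⌊ ℓ /2⌋)

-- The coefficient of uˡxⁿyᵏ in F, with l = ℓ: the generating function is exponential in both sizes.
pathWeight : (n k ℓ : ℕ) → ℚ
pathWeight n k ℓ = fromℕ (pathCount n k ℓ) ℚ.* (1/ n ! ℚ.* 1/ k !)

surjections-< : ∀ {n m} → n ℕ.< m → surjections n m ≡ 0
surjections-< {zero}  {suc m} _             = ≡.refl
surjections-< {suc n} {suc m} (ℕ.s≤s n<m) = ≡.trans
  (≡.cong₂ (λ a b → suc m ℕ.* (a ℕ.+ b)) (surjections-< n<m) (surjections-< (ℕ.m≤n⇒m≤1+n n<m)))
  (ℕ.*-zeroʳ m)

-- Doubling is written with the 2 on the right throughout, because `suc m * 2` then reduces to two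
-- successors on `m * 2`, the step by which halving recurses.
⌊m*2/2⌋≡m : ∀ m → ⌊ m ℕ.* 2 /2⌋ ≡ m
⌊m*2/2⌋≡m zero    = ≡.refl
⌊m*2/2⌋≡m (suc m) = ≡.cong suc (⌊m*2/2⌋≡m m)

⌈m*2/2⌉≡m : ∀ m → ⌈ m ℕ.* 2 /2⌉ ≡ m
⌈m*2/2⌉≡m zero    = ≡.refl
⌈m*2/2⌉≡m (suc m) = ≡.cong suc (⌈m*2/2⌉≡m m)

pathCount-even : ∀ n k m → pathCount n k (m ℕ.* 2) ≡
  surjections n (suc m) ℕ.* surjections k m ℕ.+ surjections n m ℕ.* surjections k (suc m)
pathCount-even n k m rewrite ⌊m*2/2⌋≡m m | ⌈m*2/2⌉≡m m = ≡.refl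

-- At odd length there are as many even as odd levels, so the two summands coincide. This is the 2
-- in 2uXᵐ⁺¹Yᵐ⁺¹.
pathCount-odd : ∀ n k m → pathCount n k (suc (m ℕ.* 2)) ≡
  surjections n (suc m) ℕ.* surjections k (suc m) ℕ.+ surjections n (suc m) ℕ.* surjections k (suc m)
pathCount-odd n k m rewrite ⌊m*2/2⌋≡m m | ⌈m*2/2⌉≡m m = ≡.refl

-- Power series in two variables

module GeometricSum (A : CommutativeRing 0ℓ 0ℓ) where
  open CommutativeRing A
  open SemiringSum semiring
  open SemiringExp semiring using (_^_; ^-congˡ)
  open CommutativeSemiringExp commutativeSemiring using (^-distrib-*)
  open RingProperties ring using ([y-z]x≈yx-zx)
  open SemiringSolver commutativeSemiring using (solve; _:=_; _:+_; _:*_; con)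
  open ≈-Reasoning setoid

  -- Trades an equation between differences for one between sums, which the semiring solver can
  -- decide.
  x+q≈y+p⇒x-p≈y-q : ∀ {x y p q} → x + q ≈ y + p → x - p ≈ y - q
  x+q≈y+p⇒x-p≈y-q {x} {y} {p} {q} eq = begin
    x - p                      ≈⟨ +-identityʳ _ ⟨
    (x - p) + 0#               ≈⟨ +-congˡ (-‿inverseʳ q) ⟨
    (x - p) + (q - q)
      ≈⟨ solve 4 (λ a b c d → (a :+ b) :+ (c :+ d) := (a :+ c) :+ (b :+ d)) refl x (- p) q (- q) ⟩
    (x + q) + (- p + - q)      ≈⟨ +-congʳ eq ⟩
    (y + p) + (- p + - q)
      ≈⟨ solve 4 (λ a b c d → (a :+ b) :+ (c :+ d) := (a :+ d) :+ (b :+ c)) refl y p (- p) (- q) ⟩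
    (y - q) + (p - p)          ≈⟨ +-congˡ (-‿inverseʳ p) ⟩
    (y - q) + 0#               ≈⟨ +-identityʳ _ ⟩
    y - q                      ∎

  y+[x-y]≈x : ∀ x y → y + (x - y) ≈ x
  y+[x-y]≈x x y = begin
    y + (x - y)   ≈⟨ solve 3 (λ x y z → y :+ (x :+ z) := x :+ (y :+ z)) refl x y (- y) ⟩
    x + (y - y)   ≈⟨ +-congˡ (-‿inverseʳ y) ⟩
    x + 0#        ≈⟨ +-identityʳ x ⟩
    x             ∎

  geometric : Carrier → ℕ → Carrier
  geometric q M = sum {suc M} (λ i → q ^ toℕ i)

  geometric-suc : ∀ q M → geometric q (suc M) ≈ 1# + q * geometric q M
  geometric-suc q M = +-congˡ (sym (*-distribˡ-sum {suc M} q (λ i → q ^ toℕ i)))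

  geometric-+ : ∀ q M → geometric q M + q ^ suc M ≈ 1# + q * geometric q M
  geometric-+ q zero    = solve 1 (λ q → (con 1 :+ con 0) :+ q :* con 1 := con 1 :+ q :* (con 1 :+ con 0)) refl q
  geometric-+ q (suc M) = begin
    geometric q (suc M) + q * q ^ suc M          ≈⟨ +-congʳ (geometric-suc q M) ⟩
    (1# + q * geometric q M) + q * q ^ suc M
      ≈⟨ solve 3 (λ q g t → (con 1 :+ q :* g) :+ q :* t := con 1 :+ q :* (g :+ t)) refl q (geometric q M) (q ^ suc M) ⟩
    1# + q * (geometric q M + q ^ suc M)
      ≈⟨ +-congˡ (*-congˡ (trans (geometric-+ q M) (sym (geometric-suc q M)))) ⟩
    1# + q * geometric q (suc M)                 ∎

  [1-q]*geometric : ∀ q M → (1# - q) * geometric q M ≈ 1# - q ^ suc M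
  [1-q]*geometric q M = begin
    (1# - q) * g      ≈⟨ [y-z]x≈yx-zx g 1# q ⟩
    1# * g - q * g    ≈⟨ +-congʳ (*-identityˡ g) ⟩
    g - q * g         ≈⟨ x+q≈y+p⇒x-p≈y-q (geometric-+ q M) ⟩
    1# - q ^ suc M    ∎
    where g = geometric q M

  -- For reading off coefficients in ℚ[u]: the common factor u² is pulled out as two single
  -- multiplications by u, each of which shifts the coefficients by one.
  horner : ∀ u (g : ℕ → Carrier) M → sum {suc (suc M)} (λ i → (u ^ 2) ^ toℕ i * g (toℕ i)) ≈
           1# * g 0 + u * (u * sum {suc M} (λ i → (u ^ 2) ^ toℕ i * g (suc (toℕ i))))
  horner u g M = +-congˡ (begin
    sum {suc M} (λ i → u ^ 2 * (u ^ 2) ^ toℕ i * g (suc (toℕ i)))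
      ≈⟨ sum-cong-≋ {suc M} (λ i → *-assoc (u ^ 2) ((u ^ 2) ^ toℕ i) (g (suc (toℕ i)))) ⟩
    sum {suc M} (λ i → u ^ 2 * ((u ^ 2) ^ toℕ i * g (suc (toℕ i))))
      ≈⟨ *-distribˡ-sum {suc M} (u ^ 2) (λ i → (u ^ 2) ^ toℕ i * g (suc (toℕ i))) ⟨
    u ^ 2 * s
      ≈⟨ solve 2 (λ u s → u :* (u :* con 1) :* s := u :* (u :* s)) refl u s ⟩
    u * (u * s) ∎)
    where s = sum {suc M} (λ i → (u ^ 2) ^ toℕ i * g (suc (toℕ i)))

  module _ (u x y : Carrier) where

    private
      q w : Carrier
      q = u ^ 2 * x * y
      w = (x + y) + u * (x * y + x * y)

    numerator : ∀ {e} → e ≈ (1# + x) * (1# + y) → e - (u - 1#) ^ 2 * x * y ≈ (1# - q) + w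
    numerator {e} e≈ = begin
      e - v ^ 2 * x * y   ≈⟨ x+q≈y+p⇒x-p≈y-q balanced ⟩
      (1# + w) - q        ≈⟨ solve 3 (λ i w q → (i :+ w) :+ q := (i :+ q) :+ w) refl 1# w (- q) ⟩
      (1# - q) + w        ∎
      where
      v = u - 1#
      -- In terms of v = u - 1 there is no subtraction left.
      balanced : e + q ≈ (1# + w) + v ^ 2 * x * y
      balanced = begin
        e + u ^ 2 * x * y
          ≈⟨ +-cong e≈ (*-congʳ (*-congʳ (^-congˡ 2 (sym (y+[x-y]≈x u 1#))))) ⟩
        (1# + x) * (1# + y) + (1# + v) ^ 2 * x * y
          ≈⟨ solve 3 (λ x y v →
               (con 1 :+ x) :* (con 1 :+ y) :+ (con 1 :+ v) :* ((con 1 :+ v) :* con 1) :* x :* y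
               := (con 1 :+ ((x :+ y) :+ (con 1 :+ v) :* (x :* y :+ x :* y))) :+ v :* (v :* con 1) :* x :* y)
             refl x y v ⟩
        (1# + ((x + y) + (1# + v) * (x * y + x * y))) + v ^ 2 * x * y
          ≈⟨ +-congʳ (+-congˡ (+-congˡ (*-congʳ (y+[x-y]≈x u 1#)))) ⟩
        (1# + w) + v ^ 2 * x * y ∎

    -- The factor 2 is spelled as a repeated summand, so that both parentheses have the two-product
    -- shape of `pathCount`.
    term : ℕ → Carrier
    term m = (x ^ suc m * y ^ m + x ^ m * y ^ suc m) + u * (x ^ suc m * y ^ suc m + x ^ suc m * y ^ suc m)

    q^m : ∀ m → q ^ m ≈ (u ^ 2) ^ m * (x ^ m * y ^ m)
    q^m m = begin
      (u ^ 2 * x * y) ^ m            ≈⟨ ^-distrib-* (u ^ 2 * x) y m ⟩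
      (u ^ 2 * x) ^ m * y ^ m        ≈⟨ *-congʳ (^-distrib-* (u ^ 2) x m) ⟩
      (u ^ 2) ^ m * x ^ m * y ^ m    ≈⟨ *-assoc _ _ _ ⟩
      (u ^ 2) ^ m * (x ^ m * y ^ m)  ∎

    w*q^m : ∀ m → w * q ^ m ≈ (u ^ 2) ^ m * term m
    w*q^m m = begin
      w * q ^ m
        ≈⟨ *-congˡ (q^m m) ⟩
      w * ((u ^ 2) ^ m * (x ^ m * y ^ m))
        ≈⟨ solve 6 (λ u x y p a b → ((x :+ y) :+ u :* (x :* y :+ x :* y)) :* (p :* (a :* b)) :=
             p :* ((x :* a :* b :+ a :* (y :* b)) :+ u :* (x :* a :* (y :* b) :+ x :* a :* (y :* b))))
           refl u x y ((u ^ 2) ^ m) (x ^ m) (y ^ m) ⟩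
      (u ^ 2) ^ m * term m ∎

    -- The exact finite form of the expansion of F. By `numerator` the first factor is (1 - q) + w;
    -- the part 1 - q telescopes against the geometric sum and leaves the remainder, while w
    -- distributes over the powers of q.
    fraction : ∀ {e} → e ≈ (1# + x) * (1# + y) → ∀ M → (e - (u - 1#) ^ 2 * x * y) * geometric q M ≈
                     (1# - q ^ suc M) + sum {suc M} (λ i → (u ^ 2) ^ toℕ i * term (toℕ i))
    fraction {e} e≈ M = begin
      (e - (u - 1#) ^ 2 * x * y) * geometric q M
        ≈⟨ *-congʳ (numerator e≈) ⟩
      ((1# - q) + w) * geometric q M
        ≈⟨ distribʳ _ _ _ ⟩
      (1# - q) * geometric q M + w * geometric q M
        ≈⟨ +-cong ([1-q]*geometric q M) (trans (*-distribˡ-sum {suc M} w (λ i → q ^ toℕ i))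
             (sum-cong-≋ {suc M} (λ i → w*q^m (toℕ i)))) ⟩
      (1# - q ^ suc M) + sum {suc M} (λ i → (u ^ 2) ^ toℕ i * term (toℕ i)) ∎

-- The coefficients of F over a commutative ring

IsCommutative : RawRing 0ℓ 0ℓ → Set
IsCommutative R = IsCommutativeRing _≈_ _+_ _*_ -_ 0# 1#
  where open RawRing R

-- The raw ring R is a parameter so that F below is literally the series of the theorem; for the raw
-- ring of a bundled commutative ring the two are only equal after unfolding F.
module Bivariate (R : RawRing 0ℓ 0ℓ) (R-isCommutative : IsCommutative R)
  (ι : ℚ → RawRing.Carrier R) (ι-isHom : IsRingHomomorphism ℚ.+-*-rawRing R ι) where

  open RawRing R

  𝐑 : CommutativeRing 0ℓ 0ℓ
  𝐑 = record { isCommutativeRing = R-isCommutative }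

  open CommutativeRing 𝐑 hiding (Carrier; _≈_; _+_; _*_; -_; 0#; 1#; rawRing)
  open PowerSeries R ι hiding (_-_)
  open IsRingHomomorphism ι-isHom using (+-homo; *-homo; 0#-homo; 1#-homo)
  open SemiringSum semiring
  open RawSemiringDefs rawSemiring using () renaming (_^_ to _^ᴿ_)
  module U = Convolution 𝐑
  open U using (_⊛_; _≋_; 𝟙)
  module B = Convolution U.⊛-ring

  ι-cong : ∀ {p q} → p ≡ q → ι p ≈ ι q
  ι-cong ≡.refl = refl

  sum-pointwise : ∀ {m} (h : Fin m → ℕ → Carrier) k →
    SemiringSum.sum (CommutativeRing.semiring U.⊛-ring) h k ≈ sum (λ i → h i k)
  sum-pointwise {zero}  h k = refl
  sum-pointwise {suc m} h k = +-congˡ (sum-pointwise (h ∘ Fin.suc) k)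

  *-⊛ : ∀ f g n k → RawRing._*_ seriesRing f g n k ≈ (f B.⊛ g) n k
  *-⊛ f g n k = sym (sum-pointwise {suc n} (λ i → f (toℕ i) ⊛ g (n ℕ.∸ toℕ i)) k)

  scalar-zero : ∀ n k → scalar 0# n k ≈ 0#
  scalar-zero zero    zero    = refl
  scalar-zero zero    (suc k) = refl
  scalar-zero (suc n) k       = refl

  scalar-one : ∀ n k → scalar 1# n k ≈ B.𝟙 n k
  scalar-one zero    zero    = refl
  scalar-one zero    (suc k) = refl
  scalar-one (suc n) k       = refl

  -- Both rings have the same functions as elements and the same equality; only the double sum of
  -- the product and the constants 0 and 1 are presented differently. The ring laws of the iterated
  -- series therefore carry over to `seriesRing`.
  seriesRing-mono : IsRingMonomorphism seriesRing (CommutativeRing.rawRing B.⊛-ring) id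
  seriesRing-mono = record
    { isRingHomomorphism = record
      { isSemiringHomomorphism = record
        { isNearSemiringHomomorphism = record
          { +-isMonoidHomomorphism = record
            { isMagmaHomomorphism = record
              { isRelHomomorphism = record { cong = id }
              ; homo = λ f g n k → refl
              }
            ; ε-homo = scalar-zero
            }
          ; *-homo = *-⊛
          }
        ; 1#-homo = scalar-one
        }
      ; -‿homo = λ f n k → refl
      }
    ; injective = id
    }

  𝕊 : CommutativeRing 0ℓ 0ℓ
  𝕊 = record { isCommutativeRing =
    RingMonomorphism.isCommutativeRing seriesRing-mono (CommutativeRing.isCommutativeRing B.⊛-ring) }

  module S = CommutativeRing 𝕊
  module Ssum = SemiringSum S.semiring
  open SemiringExp S.semiring using (_^_; ^-congˡ)
  open S using () renaming (_≈_ to _≈ˢ_; _+_ to _+ˢ_; _*_ to _*ˢ_; -_ to -ˢ_; _-_ to _-ˢ_; 1# to 1ˢ)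

  infixr 7 _⊗_
  -- The series p(x) q(y). The exponentials, X, Y and their powers all have this form, and by `⊗-*`
  -- such series multiply factor by factor, which reduces them to one variable.
  _⊗_ : (p q : ℕ → Carrier) → Series
  (p ⊗ q) n k = p n * q k

  ⊗-cong : ∀ {p p′ q q′} → p ≋ p′ → q ≋ q′ → p ⊗ q ≈ˢ p′ ⊗ q′
  ⊗-cong p≋ q≋ n k = *-cong (p≋ n) (q≋ k)

  ⊗-* : ∀ p q p′ q′ → (p ⊗ q) *ˢ (p′ ⊗ q′) ≈ˢ (p ⊛ p′) ⊗ (q ⊛ q′)
  ⊗-* p q p′ q′ n k = begin
    sum {suc n} (λ i → sum {suc k} (λ j → (p (toℕ i) * q (toℕ j)) * (p′ (n ℕ.∸ toℕ i) * q′ (k ℕ.∸ toℕ j))))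
      ≈⟨ sum-cong-≋ {suc n} (λ i → trans
           (sum-cong-≋ {suc k} (λ j → solve 4 (λ a b c d → (a :* b) :* (c :* d) := (a :* c) :* (b :* d)) refl
             (p (toℕ i)) (q (toℕ j)) (p′ (n ℕ.∸ toℕ i)) (q′ (k ℕ.∸ toℕ j))))
           (sym (*-distribˡ-sum {suc k} (p (toℕ i) * p′ (n ℕ.∸ toℕ i)) (λ j → q (toℕ j) * q′ (k ℕ.∸ toℕ j))))) ⟩
    sum {suc n} (λ i → p (toℕ i) * p′ (n ℕ.∸ toℕ i) * (q ⊛ q′) k)
      ≈⟨ *-distribʳ-sum {suc n} ((q ⊛ q′) k) (λ i → p (toℕ i) * p′ (n ℕ.∸ toℕ i)) ⟨
    (p ⊛ p′) n * (q ⊛ q′) k ∎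
    where
    open ≈-Reasoning setoid
    open SemiringSolver commutativeSemiring using (solve; _:=_; _:*_)

  𝟙⊗𝟙 : 1ˢ ≈ˢ 𝟙 ⊗ 𝟙
  𝟙⊗𝟙 zero    zero    = sym (*-identityˡ 1#)
  𝟙⊗𝟙 zero    (suc k) = sym (zeroʳ 1#)
  𝟙⊗𝟙 (suc n) k       = sym (zeroˡ _)

  scalar-* : ∀ a f n k → (scalar a *ˢ f) n k ≈ a * f n k
  scalar-* a f n k = begin
    (scalar a *ˢ f) n k   ≈⟨ *-⊛ (scalar a) f n k ⟩
    (scalar a B.⊛ f) n k  ≈⟨ B.constant-⊛ {scalar a} (λ _ _ → refl) f n k ⟩
    (scalar a 0 ⊛ f n) k  ≈⟨ U.constant-⊛ {scalar a 0} (λ _ → refl) (f n) k ⟩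
    a * f n k             ∎
    where open ≈-Reasoning setoid

  𝐱-*-zero : ∀ f k → (𝐱 *ˢ f) 0 k ≈ 0#
  𝐱-*-zero f k = trans (*-⊛ 𝐱 f 0 k) (B.shift-⊛-zero {𝐱} 𝐱₀ f k)
    where
    𝐱₀ : ∀ k → 𝐱 0 k ≈ 0#
    𝐱₀ k = refl

  𝐱-*-suc : ∀ f n k → (𝐱 *ˢ f) (suc n) k ≈ f n k
  𝐱-*-suc f n k = trans (*-⊛ 𝐱 f (suc n) k) (B.shift-⊛-suc {𝐱} (λ _ → refl) 𝐱₊ f n k)
    where
    𝐱₊ : ∀ n k → 𝐱 (suc n) k ≈ B.𝟙 n k
    𝐱₊ zero    zero    = refl
    𝐱₊ zero    (suc k) = refl
    𝐱₊ (suc n) k       = refl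

  𝐲-* : ∀ f n k → (𝐲 *ˢ f) n k ≈ (𝐲 0 ⊛ f n) k
  𝐲-* f n k = trans (*-⊛ 𝐲 f n k) (B.constant-⊛ {𝐲} (λ _ _ → refl) f n k)

  𝐲-*-zero : ∀ f n → (𝐲 *ˢ f) n 0 ≈ 0#
  𝐲-*-zero f n = trans (𝐲-* f n 0) (U.shift-⊛-zero {𝐲 0} refl (f n))

  𝐲-*-suc : ∀ f n k → (𝐲 *ˢ f) n (suc k) ≈ f n k
  𝐲-*-suc f n k = trans (𝐲-* f n (suc k)) (U.shift-⊛-suc {𝐲 0} refl 𝐲₊ (f n) k)
    where
    𝐲₊ : ∀ k → 𝐲 0 (suc k) ≈ 𝟙 k
    𝐲₊ zero    = refl
    𝐲₊ (suc k) = refl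

  Σ≤-last : ∀ N (h : ℕ → Carrier) → (∀ m → m ℕ.< N → h m ≈ 0#) → Σ≤ N h ≈ h N
  Σ≤-last zero    h h≈0 = +-identityʳ _
  Σ≤-last (suc N) h h≈0 = trans (+-cong (h≈0 0 ℕ.z<s) (Σ≤-last N (h ∘ suc) (λ m m<N → h≈0 (suc m) (ℕ.s≤s m<N))))
    (+-identityˡ _)

  Σ≤-extend : ∀ {N M} (h : ℕ → Carrier) → N ℕ.≤ M → (∀ m → N ℕ.< m → h m ≈ 0#) → Σ≤ N h ≈ Σ≤ M h
  Σ≤-extend {zero}  {zero}  h _ _ = refl
  Σ≤-extend {zero}  {suc M} h _ h≈0 = +-congˡ (sym (trans
    (sum-cong-≋ {suc M} (λ i → h≈0 (suc (toℕ i)) ℕ.z<s)) (sum-replicate-zero (suc M))))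
  Σ≤-extend {suc N} {suc M} h (ℕ.s≤s N≤M) h≈0 = +-congˡ (Σ≤-extend (h ∘ suc) N≤M (λ m N<m → h≈0 (suc m) (ℕ.s≤s N<m)))

  1ˢ-off : ∀ n k → 0 ≢ n ℕ.+ k → 1ˢ n k ≈ 0#
  1ˢ-off zero    zero    0≢0 = contradiction ≡.refl 0≢0
  1ˢ-off zero    (suc k) _   = refl
  1ˢ-off (suc n) k       _   = refl

  -- Homogeneity of degree 1, stated through the powers because `exp` is built from them. At xⁿyᵏ
  -- only the power n + k survives, and it is the last one that the truncated `exp` retains.
  Linear : Series → Set
  Linear f = ∀ m n k → m ≢ n ℕ.+ k → (f ^ m) n k ≈ 0#

  exp-linear : ∀ f → Linear f → ∀ n k → exp f n k ≈ ι (1/ n ℕ.+ k !) * (f ^ (n ℕ.+ k)) n k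
  exp-linear f lin n k = Σ≤-last (n ℕ.+ k) (λ m → ι (1/ m !) * (f ^ m) n k)
    (λ m m<n+k → trans (*-congˡ (lin m n k (ℕ.<⇒≢ m<n+k))) (zeroʳ _))

  𝐱-*-off : ∀ {f m} → (∀ n k → m ≢ n ℕ.+ k → f n k ≈ 0#) → ∀ n k → suc m ≢ n ℕ.+ k → (𝐱 *ˢ f) n k ≈ 0#
  𝐱-*-off {f} off zero    k _  = 𝐱-*-zero f k
  𝐱-*-off {f} off (suc n) k ne = trans (𝐱-*-suc f n k) (off n k (ne ∘ ≡.cong suc))

  𝐲-*-off : ∀ {f m} → (∀ n k → m ≢ n ℕ.+ k → f n k ≈ 0#) → ∀ n k → suc m ≢ n ℕ.+ k → (𝐲 *ˢ f) n k ≈ 0#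
  𝐲-*-off {f} off n zero    _  = 𝐲-*-zero f n
  𝐲-*-off {f} off n (suc k) ne = trans (𝐲-*-suc f n k)
    (off n k (λ m≡ → ne (≡.trans (≡.cong suc m≡) (≡.sym (ℕ.+-suc n k)))))

  𝐱-linear : Linear 𝐱
  𝐱-linear zero    = 1ˢ-off
  𝐱-linear (suc m) = 𝐱-*-off (𝐱-linear m)

  𝐲-linear : Linear 𝐲
  𝐲-linear zero    = 1ˢ-off
  𝐲-linear (suc m) = 𝐲-*-off (𝐲-linear m)

  𝐱+𝐲-linear : Linear (𝐱 +ˢ 𝐲)
  𝐱+𝐲-linear zero    = 1ˢ-off
  𝐱+𝐲-linear (suc m) n k ne = begin
    ((𝐱 +ˢ 𝐲) *ˢ f) n k           ≈⟨ S.distribʳ f 𝐱 𝐲 n k ⟩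
    (𝐱 *ˢ f) n k + (𝐲 *ˢ f) n k   ≈⟨ +-cong (𝐱-*-off (𝐱+𝐲-linear m) n k ne) (𝐲-*-off (𝐱+𝐲-linear m) n k ne) ⟩
    0# + 0#                       ≈⟨ +-identityˡ 0# ⟩
    0#                            ∎
    where
    open ≈-Reasoning setoid
    f = (𝐱 +ˢ 𝐲) ^ m

  𝐱^m-diagonal : ∀ m → (𝐱 ^ m) m 0 ≈ 1#
  𝐱^m-diagonal zero    = refl
  𝐱^m-diagonal (suc m) = trans (𝐱-*-suc (𝐱 ^ m) m 0) (𝐱^m-diagonal m)

  𝐲^m-diagonal : ∀ m → (𝐲 ^ m) 0 m ≈ 1#
  𝐲^m-diagonal zero    = refl
  𝐲^m-diagonal (suc m) = trans (𝐲-*-suc (𝐲 ^ m) 0 m) (𝐲^m-diagonal m)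

  𝐱^m-suc : ∀ m n k → (𝐱 ^ m) n (suc k) ≈ 0#
  𝐱^m-suc zero    zero    k = refl
  𝐱^m-suc zero    (suc n) k = refl
  𝐱^m-suc (suc m) zero    k = 𝐱-*-zero (𝐱 ^ m) (suc k)
  𝐱^m-suc (suc m) (suc n) k = trans (𝐱-*-suc (𝐱 ^ m) n (suc k)) (𝐱^m-suc m n k)

  𝐲^m-suc : ∀ m n k → (𝐲 ^ m) (suc n) k ≈ 0#
  𝐲^m-suc zero    n k       = refl
  𝐲^m-suc (suc m) n zero    = 𝐲-*-zero (𝐲 ^ m) (suc n)
  𝐲^m-suc (suc m) n (suc k) = trans (𝐲-*-suc (𝐲 ^ m) (suc n) k) (𝐲^m-suc m n k)

  E : ℕ → Carrier
  E n = ι (1/ n !)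

  exp-𝐱 : exp 𝐱 ≈ˢ E ⊗ 𝟙
  exp-𝐱 n zero    = trans (exp-linear 𝐱 𝐱-linear n 0) (*-cong (ι-cong (≡.cong 1/_! (ℕ.+-identityʳ n)))
    (≡.subst (λ m → (𝐱 ^ m) n 0 ≈ 1#) (≡.sym (ℕ.+-identityʳ n)) (𝐱^m-diagonal n)))
  exp-𝐱 n (suc k) = trans (exp-linear 𝐱 𝐱-linear n (suc k))
    (trans (*-congˡ (𝐱^m-suc (n ℕ.+ suc k) n k)) (trans (zeroʳ _) (sym (zeroʳ _))))

  exp-𝐲 : exp 𝐲 ≈ˢ 𝟙 ⊗ E
  exp-𝐲 zero    k = trans (exp-linear 𝐲 𝐲-linear 0 k) (trans (*-congˡ (𝐲^m-diagonal k)) (*-comm _ _))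
  exp-𝐲 (suc n) k = trans (exp-linear 𝐲 𝐲-linear (suc n) k)
    (trans (*-congˡ (𝐲^m-suc (suc n ℕ.+ k) n k)) (trans (zeroʳ _) (sym (zeroˡ _))))


  -- Pascal's rule in factorials: splitting off an x leaves m! n/(n! k!), splitting off a y leaves
  -- m! k/(n! k!), and n + k = m + 1 turns the sum into (m + 1)!/(n! k!). The factors n and k cover
  -- the boundary cases, where they are 0. The exponent is a separate variable since the induction
  -- may lower either index.
  binomial : ∀ m n k → m ≡ n ℕ.+ k → ((𝐱 +ˢ 𝐲) ^ m) n k ≈ ι (fromℕ (m !) ℚ.* (1/ n ! ℚ.* 1/ k !))
  binomial zero    zero    zero    _   = sym 1#-homo
  binomial (suc m) n k m+1≡n+k = begin
    ((𝐱 +ˢ 𝐲) *ˢ f) n k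
      ≈⟨ S.distribʳ f 𝐱 𝐲 n k ⟩
    (𝐱 *ˢ f) n k + (𝐲 *ˢ f) n k
      ≈⟨ +-cong (𝐱-part n k m+1≡n+k) (𝐲-part n k m+1≡n+k) ⟩
    ι (m! ℚ.* (fromℕ n ℚ.* 1/ n ! ℚ.* 1/ k !)) + ι (m! ℚ.* (1/ n ! ℚ.* (fromℕ k ℚ.* 1/ k !)))
      ≈⟨ +-homo _ _ ⟨
    ι (m! ℚ.* (fromℕ n ℚ.* 1/ n ! ℚ.* 1/ k !) ℚ.+ m! ℚ.* (1/ n ! ℚ.* (fromℕ k ℚ.* 1/ k !)))
      ≈⟨ ι-cong (ℚSolver.solve 5 (λ m n k p q → m :* (n :* p :* q) :+ m :* (p :* (k :* q)) := (n :+ k) :* m :* (p :* q))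
           ≡.refl m! (fromℕ n) (fromℕ k) (1/ n !) (1/ k !)) ⟩
    ι ((fromℕ n ℚ.+ fromℕ k) ℚ.* m! ℚ.* (1/ n ! ℚ.* 1/ k !))
      ≈⟨ ι-cong (≡.cong (ℚ._* (1/ n ! ℚ.* 1/ k !)) coefficient) ⟨
    ι (fromℕ (suc m !) ℚ.* (1/ n ! ℚ.* 1/ k !)) ∎
    where
    open ≈-Reasoning setoid
    open ℚSolver using (_:=_; _:+_; _:*_)
    f = (𝐱 +ˢ 𝐲) ^ m
    m! = fromℕ (m !)

    coefficient : fromℕ (suc m !) ≡ (fromℕ n ℚ.+ fromℕ k) ℚ.* m!
    coefficient = ≡.trans (×1-homo-* (suc m) (m !))
      (≡.cong (ℚ._* m!) (≡.trans (≡.cong fromℕ m+1≡n+k) (×-homo-+ 1ℚ n k)))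

    ι-zero : ∀ q {r} → r ≡ 0ℚ → 0# ≈ ι (q ℚ.* r)
    ι-zero q ≡.refl = sym (trans (ι-cong (ℚ.*-zeroʳ q)) 0#-homo)

    𝐱-part : ∀ n k → suc m ≡ n ℕ.+ k → (𝐱 *ˢ f) n k ≈ ι (m! ℚ.* (fromℕ n ℚ.* 1/ n ! ℚ.* 1/ k !))
    𝐱-part zero    k _  = trans (𝐱-*-zero f k) (ι-zero m! (ℚ.*-zeroˡ (1/ k !)))
    𝐱-part (suc n) k eq = trans (𝐱-*-suc f n k) (trans (binomial m n k (ℕ.suc-injective eq))
      (ι-cong (≡.cong (λ z → m! ℚ.* (z ℚ.* 1/ k !)) (≡.sym (1/!-suc n)))))

    𝐲-part : ∀ n k → suc m ≡ n ℕ.+ k → (𝐲 *ˢ f) n k ≈ ι (m! ℚ.* (1/ n ! ℚ.* (fromℕ k ℚ.* 1/ k !)))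
    𝐲-part n zero    _  = trans (𝐲-*-zero f n) (ι-zero m! (ℚ.*-zeroʳ (1/ n !)))
    𝐲-part n (suc k) eq = trans (𝐲-*-suc f n k)
      (trans (binomial m n k (ℕ.suc-injective (≡.trans eq (ℕ.+-suc n k))))
      (ι-cong (≡.cong (λ z → m! ℚ.* (1/ n ! ℚ.* z)) (≡.sym (1/!-suc k)))))

  exp-𝐱+𝐲 : exp (𝐱 +ˢ 𝐲) ≈ˢ E ⊗ E
  exp-𝐱+𝐲 n k = begin
    exp (𝐱 +ˢ 𝐲) n k
      ≈⟨ exp-linear (𝐱 +ˢ 𝐲) 𝐱+𝐲-linear n k ⟩
    ι (1/ n ℕ.+ k !) * ((𝐱 +ˢ 𝐲) ^ (n ℕ.+ k)) n k
      ≈⟨ *-congˡ (binomial (n ℕ.+ k) n k ≡.refl) ⟩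
    ι (1/ n ℕ.+ k !) * ι (fromℕ ((n ℕ.+ k) !) ℚ.* (1/ n ! ℚ.* 1/ k !))
      ≈⟨ *-homo _ _ ⟨
    ι (1/ n ℕ.+ k ! ℚ.* (fromℕ ((n ℕ.+ k) !) ℚ.* (1/ n ! ℚ.* 1/ k !)))
      ≈⟨ ι-cong (≡.trans (≡.sym (ℚ.*-assoc (1/ n ℕ.+ k !) (fromℕ ((n ℕ.+ k) !)) (1/ n ! ℚ.* 1/ k !)))
           (≡.trans (≡.cong (ℚ._* (1/ n ! ℚ.* 1/ k !)) (/-fromℕ 1 ((n ℕ.+ k) !) {{(n ℕ.+ k) ℕ.!≢0}})) (ℚ.*-identityˡ (1/ n ! ℚ.* 1/ k !)))) ⟩
    ι (1/ n ! ℚ.* 1/ k !)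
      ≈⟨ *-homo _ _ ⟩
    E n * E k ∎
    where open ≈-Reasoning setoid

  exp-+ : exp (𝐱 +ˢ 𝐲) ≈ˢ exp 𝐱 *ˢ exp 𝐲
  exp-+ = begin
    exp (𝐱 +ˢ 𝐲)        ≈⟨ exp-𝐱+𝐲 ⟩
    E ⊗ E                ≈⟨ ⊗-cong (λ n → trans (U.⊛-comm E 𝟙 n) (U.⊛-identityˡ E n)) (U.⊛-identityˡ E) ⟨
    (E ⊛ 𝟙) ⊗ (𝟙 ⊛ E)   ≈⟨ ⊗-* E 𝟙 𝟙 E ⟨
    (E ⊗ 𝟙) *ˢ (𝟙 ⊗ E)  ≈⟨ S.*-cong exp-𝐱 exp-𝐲 ⟨
    exp 𝐱 *ˢ exp 𝐲      ∎
    where open ≈-Reasoning S.setoid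

  X Y : Series
  X = exp 𝐱 -ˢ 1ˢ
  Y = exp 𝐲 -ˢ 1ˢ

  E-1 : ℕ → Carrier
  E-1 n = ι (expSeries-1 n)

  E-𝟙 : ∀ n → E n - 𝟙 n ≈ E-1 n
  E-𝟙 zero    = trans (+-congʳ 1#-homo) (trans (-‿inverseʳ 1#) (sym 0#-homo))
  E-𝟙 (suc n) = trans (+-congˡ (RingProperties.-0#≈0# ring)) (+-identityʳ _)

  X-⊗ : X ≈ˢ E-1 ⊗ 𝟙
  X-⊗ n k = begin
    exp 𝐱 n k - 1ˢ n k      ≈⟨ +-cong (exp-𝐱 n k) (-‿cong (𝟙⊗𝟙 n k)) ⟩
    E n * 𝟙 k - 𝟙 n * 𝟙 k   ≈⟨ RingProperties.[y-z]x≈yx-zx ring _ _ _ ⟨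
    (E n - 𝟙 n) * 𝟙 k       ≈⟨ *-congʳ (E-𝟙 n) ⟩
    E-1 n * 𝟙 k             ∎
    where open ≈-Reasoning setoid

  Y-⊗ : Y ≈ˢ 𝟙 ⊗ E-1
  Y-⊗ n k = begin
    exp 𝐲 n k - 1ˢ n k      ≈⟨ +-cong (exp-𝐲 n k) (-‿cong (𝟙⊗𝟙 n k)) ⟩
    𝟙 n * E k - 𝟙 n * 𝟙 k   ≈⟨ RingProperties.x[y-z]≈xy-xz ring _ _ _ ⟨
    𝟙 n * (E k - 𝟙 k)       ≈⟨ *-congˡ (E-𝟙 k) ⟩
    𝟙 n * E-1 k             ∎
    where open ≈-Reasoning setoid

  ι-⊛ : ∀ f g n → ((ι ∘ f) ⊛ (ι ∘ g)) n ≈ ι ((f ℚ⊛.⊛ g) n)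
  ι-⊛ f g zero    = trans (+-cong (sym (*-homo _ _)) (sym 0#-homo)) (sym (+-homo _ _))
  ι-⊛ f g (suc n) = trans (+-cong (sym (*-homo _ _)) (ι-⊛ (f ∘ suc) g n)) (sym (+-homo _ _))

  σ : ℕ → ℕ → Carrier
  σ m n = ι (surjectionSeries m n)

  σ-zero : σ 0 ≋ 𝟙
  σ-zero zero    = trans (ι-cong (surjectionSeries-zero 0)) 1#-homo
  σ-zero (suc n) = trans (ι-cong (surjectionSeries-zero (suc n))) 0#-homo

  σ-suc : ∀ m → E-1 ⊛ σ m ≋ σ (suc m)
  σ-suc m n = trans (ι-⊛ expSeries-1 (surjectionSeries m) n) (ι-cong (surjectionSeries-suc m n))

  X^-⊗ : ∀ a → X ^ a ≈ˢ σ a ⊗ 𝟙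
  X^-⊗ zero    = S.trans 𝟙⊗𝟙 (⊗-cong (λ n → sym (σ-zero n)) (λ _ → refl))
  X^-⊗ (suc a) = begin
    X *ˢ X ^ a               ≈⟨ S.*-cong X-⊗ (X^-⊗ a) ⟩
    (E-1 ⊗ 𝟙) *ˢ (σ a ⊗ 𝟙)   ≈⟨ ⊗-* E-1 𝟙 (σ a) 𝟙 ⟩
    (E-1 ⊛ σ a) ⊗ (𝟙 ⊛ 𝟙)    ≈⟨ ⊗-cong (σ-suc a) (U.⊛-identityˡ 𝟙) ⟩
    σ (suc a) ⊗ 𝟙            ∎
    where open ≈-Reasoning S.setoid

  Y^-⊗ : ∀ b → Y ^ b ≈ˢ 𝟙 ⊗ σ b
  Y^-⊗ zero    = S.trans 𝟙⊗𝟙 (⊗-cong (λ _ → refl) (λ n → sym (σ-zero n)))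
  Y^-⊗ (suc b) = begin
    Y *ˢ Y ^ b               ≈⟨ S.*-cong Y-⊗ (Y^-⊗ b) ⟩
    (𝟙 ⊗ E-1) *ˢ (𝟙 ⊗ σ b)   ≈⟨ ⊗-* 𝟙 E-1 𝟙 (σ b) ⟩
    (𝟙 ⊛ 𝟙) ⊗ (E-1 ⊛ σ b)    ≈⟨ ⊗-cong (U.⊛-identityˡ 𝟙) (σ-suc b) ⟩
    𝟙 ⊗ σ (suc b)            ∎
    where open ≈-Reasoning S.setoid

  X^*Y^ : ∀ a b → X ^ a *ˢ Y ^ b ≈ˢ σ a ⊗ σ b
  X^*Y^ a b = begin
    X ^ a *ˢ Y ^ b             ≈⟨ S.*-cong (X^-⊗ a) (Y^-⊗ b) ⟩
    (σ a ⊗ 𝟙) *ˢ (𝟙 ⊗ σ b)     ≈⟨ ⊗-* (σ a) 𝟙 𝟙 (σ b) ⟩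
    (σ a ⊛ 𝟙) ⊗ (𝟙 ⊛ σ b)
      ≈⟨ ⊗-cong (λ n → trans (U.⊛-comm (σ a) 𝟙 n) (U.⊛-identityˡ (σ a) n)) (U.⊛-identityˡ (σ b)) ⟩
    σ a ⊗ σ b                  ∎
    where open ≈-Reasoning S.setoid

  σ-< : ∀ {n m} → n ℕ.< m → σ m n ≈ 0#
  σ-< {n} n<m = trans (ι-cong (≡.trans (≡.cong (λ s → fromℕ s ℚ.* 1/ n !) (surjections-< n<m)) (ℚ.*-zeroˡ (1/ n !)))) 0#-homo

  Ssum-pointwise : ∀ {m} (h : Fin m → Series) n k → Ssum.sum h n k ≈ sum (λ i → h i n k)
  Ssum-pointwise {zero}  h n k = scalar-zero n k
  Ssum-pointwise {suc m} h n k = +-congˡ (Ssum-pointwise (h ∘ Fin.suc) n k)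

  -- Lets the inverse in F be replaced by one finite geometric sum, with which it is shown to agree
  -- only up to a given total degree.
  *ˢ-local : ∀ f {g g′} n k → (∀ i j → i ℕ.≤ n → j ℕ.≤ k → g i j ≈ g′ i j) → (f *ˢ g) n k ≈ (f *ˢ g′) n k
  *ˢ-local f n k g≈ = sum-cong-≋ {suc n} λ i → sum-cong-≋ {suc k} λ j →
    *-congˡ {f (toℕ i) (toℕ j)} (g≈ (n ℕ.∸ toℕ i) (k ℕ.∸ toℕ j) (ℕ.m∸n≤m n (toℕ i)) (ℕ.m∸n≤m k (toℕ j)))

  σ-* : ∀ n k a b → σ a n * σ b k ≈ ι (fromℕ (surjections n a ℕ.* surjections k b) ℚ.* (1/ n ! ℚ.* 1/ k !))
  σ-* n k a b = trans (sym (*-homo _ _)) (ι-cong (begin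
    (fromℕ s ℚ.* 1/ n !) ℚ.* (fromℕ t ℚ.* 1/ k !)
      ≡⟨ ℚSolver.solve 4 (λ s p t q → (s :* p) :* (t :* q) := (s :* t) :* (p :* q)) ≡.refl (fromℕ s) (1/ n !) (fromℕ t) (1/ k !) ⟩
    (fromℕ s ℚ.* fromℕ t) ℚ.* (1/ n ! ℚ.* 1/ k !)  ≡⟨ ≡.cong (ℚ._* (1/ n ! ℚ.* 1/ k !)) (×1-homo-* s t) ⟨
    fromℕ (s ℕ.* t) ℚ.* (1/ n ! ℚ.* 1/ k !)        ∎))
    where
    open ≡.≡-Reasoning
    open ℚSolver using (_:=_; _:*_)
    s = surjections n a
    t = surjections k b

  σ-*+* : ∀ n k a b a′ b′ {c} → c ≡ surjections n a ℕ.* surjections k b ℕ.+ surjections n a′ ℕ.* surjections k b′ →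
    σ a n * σ b k + σ a′ n * σ b′ k ≈ ι (fromℕ c ℚ.* (1/ n ! ℚ.* 1/ k !))
  σ-*+* n k a b a′ b′ ≡.refl = trans (+-cong (σ-* n k a b) (σ-* n k a′ b′)) (trans (sym (+-homo _ _))
    (ι-cong (≡.trans (≡.sym (ℚ.*-distribʳ-+ w (fromℕ s) (fromℕ t))) (≡.cong (ℚ._* w) (≡.sym (×-homo-+ 1ℚ s t))))))
    where
    w = 1/ n ! ℚ.* 1/ k !
    s = surjections n a ℕ.* surjections k b
    t = surjections n a′ ℕ.* surjections k b′

  module _ (a : Carrier) where

    private
      module G = GeometricSum 𝕊
      u Q N : Series
      u = scalar a
      Q = u ^ 2 *ˢ X *ˢ Y
      N = exp (𝐱 +ˢ 𝐲) -ˢ (u -ˢ 1ˢ) ^ 2 *ˢ X *ˢ Y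

    exp-1+X : exp (𝐱 +ˢ 𝐲) ≈ˢ (1ˢ +ˢ X) *ˢ (1ˢ +ˢ Y)
    exp-1+X = S.trans exp-+ (S.*-cong (S.sym (G.y+[x-y]≈x (exp 𝐱) 1ˢ)) (S.sym (G.y+[x-y]≈x (exp 𝐲) 1ˢ)))

    -- Formulated for any series that acts like a scalar, so that it applies first to u and then to
    -- u².
    ^-*-coeff : ∀ {c b} → (∀ f n k → (c *ˢ f) n k ≈ b * f n k) → ∀ m f n k → ((c ^ m) *ˢ f) n k ≈ b ^ᴿ m * f n k
    ^-*-coeff         c*≈ zero    f n k = trans (S.*-identityˡ f n k) (sym (*-identityˡ _))
    ^-*-coeff {c} {b} c*≈ (suc m) f n k = begin
      ((c *ˢ c ^ m) *ˢ f) n k  ≈⟨ S.*-assoc c (c ^ m) f n k ⟩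
      (c *ˢ (c ^ m *ˢ f)) n k  ≈⟨ c*≈ (c ^ m *ˢ f) n k ⟩
      b * (c ^ m *ˢ f) n k     ≈⟨ *-congˡ (^-*-coeff c*≈ m f n k) ⟩
      b * (b ^ᴿ m * f n k)     ≈⟨ *-assoc _ _ _ ⟨
      b ^ᴿ suc m * f n k       ∎
      where open ≈-Reasoning setoid

    u²^m-* : ∀ m f n k → ((u ^ 2) ^ m *ˢ f) n k ≈ (a ^ᴿ 2) ^ᴿ m * f n k
    u²^m-* = ^-*-coeff {u ^ 2} (^-*-coeff {u} (scalar-* a) 2)

    -- The power contains Xᵐ, and n points have no surjection onto more than n points.
    Q^m-vanishes : ∀ {m n} k → n ℕ.< m → (Q ^ m) n k ≈ 0#
    Q^m-vanishes {m} {n} k n<m = begin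
      (Q ^ m) n k                               ≈⟨ G.q^m u X Y m n k ⟩
      ((u ^ 2) ^ m *ˢ (X ^ m *ˢ Y ^ m)) n k     ≈⟨ u²^m-* m (X ^ m *ˢ Y ^ m) n k ⟩
      (a ^ᴿ 2) ^ᴿ m * (X ^ m *ˢ Y ^ m) n k
        ≈⟨ *-congˡ (trans (X^*Y^ m m n k) (trans (*-congʳ (σ-< n<m)) (zeroˡ _))) ⟩
      (a ^ᴿ 2) ^ᴿ m * 0#                        ≈⟨ zeroʳ _ ⟩
      0#                                        ∎
      where open ≈-Reasoning setoid

    -- The inverse stops at n + k, a bound that moves with the coefficient, whereas `fraction` needs
    -- one M for all coefficients. Raising the bound to M only adds vanishing powers of Q.
    inverse-geometric : ∀ {M} n k → n ℕ.+ k ℕ.≤ M → ((1ˢ -ˢ Q) ⁻¹) n k ≈ G.geometric Q M n k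
    inverse-geometric {M} n k n+k≤M = begin
      Σ≤ (n ℕ.+ k) (λ m → ((1ˢ -ˢ (1ˢ -ˢ Q)) ^ m) n k)
        ≈⟨ sum-cong-≋ {suc (n ℕ.+ k)} (λ i → ^-congˡ (toℕ i) 1-[1-Q] n k) ⟩
      Σ≤ (n ℕ.+ k) (λ m → (Q ^ m) n k)
        ≈⟨ Σ≤-extend (λ m → (Q ^ m) n k) n+k≤M (λ m n+k<m → Q^m-vanishes k (ℕ.≤-<-trans (ℕ.m≤m+n n k) n+k<m)) ⟩
      Σ≤ M (λ m → (Q ^ m) n k)
        ≈⟨ Ssum-pointwise {suc M} (λ i → Q ^ toℕ i) n k ⟨
      G.geometric Q M n k ∎
      where
      open ≈-Reasoning setoid
      1-[1-Q] : 1ˢ -ˢ (1ˢ -ˢ Q) ≈ˢ Q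
      1-[1-Q] = S.trans (G.x+q≈y+p⇒x-p≈y-q {1ˢ} {Q} {1ˢ -ˢ Q} {S.0#}
          (S.trans (S.+-identityʳ 1ˢ) (S.sym (G.y+[x-y]≈x 1ˢ Q))))
        (S.trans (S.+-congˡ {Q} (RingProperties.-0#≈0# S.ring)) (S.+-identityʳ Q))

    -- The summand 1 of F sits at x⁰y⁰, which the hypothesis excludes, and the remainder of the
    -- geometric sum vanishes because n < M + 1. The lengths 2m and 2m + 1 stay paired, as `term`
    -- delivers them.
    F-coefficient : ∀ n k → 0 ≢ n ℕ.+ k → F a n k ≈ Σ≤ (n ℕ.+ k) λ m →
      (a ^ᴿ 2) ^ᴿ m * (ι (pathWeight n k (m ℕ.* 2)) + a * ι (pathWeight n k (suc (m ℕ.* 2))))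
    F-coefficient n k 0≢n+k = begin
      (N *ˢ (1ˢ -ˢ Q) ⁻¹) n k
        ≈⟨ *ˢ-local N n k (λ i j i≤n j≤k → inverse-geometric i j (ℕ.+-mono-≤ i≤n j≤k)) ⟩
      (N *ˢ G.geometric Q M) n k
        ≈⟨ G.fraction u X Y exp-1+X M n k ⟩
      (1ˢ n k - (Q ^ suc M) n k) + Ssum.sum {suc M} (λ i → (u ^ 2) ^ toℕ i *ˢ t (toℕ i)) n k
        ≈⟨ +-cong (+-cong (1ˢ-off n k 0≢n+k) (trans (-‿cong (Q^m-vanishes k (ℕ.s≤s (ℕ.m≤m+n n k)))) (RingProperties.-0#≈0# ring)))
             (Ssum-pointwise {suc M} (λ i → (u ^ 2) ^ toℕ i *ˢ t (toℕ i)) n k) ⟩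
      (0# + 0#) + Σ≤ M (λ m → ((u ^ 2) ^ m *ˢ t m) n k)
        ≈⟨ trans (+-congʳ (+-identityˡ 0#)) (+-identityˡ _) ⟩
      Σ≤ M (λ m → ((u ^ 2) ^ m *ˢ t m) n k)
        ≈⟨ sum-cong-≋ {suc M} (λ i → trans (u²^m-* (toℕ i) (t (toℕ i)) n k) (*-congˡ (t-coefficient (toℕ i)))) ⟩
      Σ≤ M (λ m → (a ^ᴿ 2) ^ᴿ m * (ι (pathWeight n k (m ℕ.* 2)) + a * ι (pathWeight n k (suc (m ℕ.* 2))))) ∎
      where
      open ≈-Reasoning setoid
      M = n ℕ.+ k
      t : ℕ → Series
      t = G.term u X Y
      t-coefficient : ∀ m → t m n k ≈ ι (pathWeight n k (m ℕ.* 2)) + a * ι (pathWeight n k (suc (m ℕ.* 2)))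
      t-coefficient m = +-cong
        (trans (+-cong (X^*Y^ (suc m) m n k) (X^*Y^ m (suc m) n k))
          (σ-*+* n k (suc m) m m (suc m) (pathCount-even n k m)))
        (trans (scalar-* a (X ^ suc m *ˢ Y ^ suc m +ˢ X ^ suc m *ˢ Y ^ suc m) n k)
          (*-congˡ (trans (+-cong (X^*Y^ (suc m) (suc m) n k) (X^*Y^ (suc m) (suc m) n k))
            (σ-*+* n k (suc m) (suc m) (suc m) (suc m) (pathCount-odd n k m)))))

-- Coefficients in u, and the value at u = 1

module Coefficients where
  open ≡ using (refl; sym; trans; cong; cong₂; module ≡-Reasoning)
  open import Data.Rational.Base using (_+_; _*_; -_)
  open ℚ⊛ using (_⊛_; _≋_; 𝟙)

  coeff-+ : ∀ p q i → coeff (p +ₚ q) i ≡ coeff p i + coeff q i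
  coeff-+ []      q       i       = sym (ℚ.+-identityˡ (coeff q i))
  coeff-+ (a ∷ p) []      i       = sym (ℚ.+-identityʳ (coeff (a ∷ p) i))
  coeff-+ (a ∷ p) (b ∷ q) zero    = refl
  coeff-+ (a ∷ p) (b ∷ q) (suc i) = coeff-+ p q i

  coeff-• : ∀ a p i → coeff (a • p) i ≡ a * coeff p i
  coeff-• a []      i       = sym (ℚ.*-zeroʳ a)
  coeff-• a (b ∷ p) zero    = refl
  coeff-• a (b ∷ p) (suc i) = coeff-• a p i

  coeff-neg : ∀ p i → coeff (List.map -_ p) i ≡ - coeff p i
  coeff-neg []      i       = refl
  coeff-neg (a ∷ p) zero    = refl
  coeff-neg (a ∷ p) (suc i) = coeff-neg p i

  coeff-* : ∀ p q → coeff (p *ₚ q) ≋ coeff p ⊛ coeff q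
  coeff-* []      q i       = sym (ℚ⊛.𝟘-⊛ (coeff q) i)
  coeff-* (a ∷ p) q zero    = trans (coeff-+ (a • q) (0ℚ ∷ (p *ₚ q)) 0) (cong (_+ 0ℚ) (coeff-• a q 0))
  coeff-* (a ∷ p) q (suc i) = trans (coeff-+ (a • q) (0ℚ ∷ (p *ₚ q)) (suc i))
    (cong₂ _+_ (coeff-• a q (suc i)) (coeff-* p q i))

  coeff-1 : coeff (constant 1ℚ) ≋ 𝟙
  coeff-1 zero    = refl
  coeff-1 (suc i) = refl

  -- Equality of polynomials is equality of coefficient sequences, so injectivity is immediate and
  -- the ring laws are pulled back from series over ℚ.
  coeff-mono : IsRingMonomorphism ℚ[u] (CommutativeRing.rawRing ℚ⊛.⊛-ring) coeff
  coeff-mono = record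
    { isRingHomomorphism = record
      { isSemiringHomomorphism = record
        { isNearSemiringHomomorphism = record
          { +-isMonoidHomomorphism = record
            { isMagmaHomomorphism = record { isRelHomomorphism = record { cong = id } ; homo = coeff-+ }
            ; ε-homo = λ _ → refl
            }
          ; *-homo = coeff-*
          }
        ; 1#-homo = coeff-1
        }
      ; -‿homo = coeff-neg
      }
    ; injective = id
    }

  ℚ[u]-ring : CommutativeRing 0ℓ 0ℓ
  ℚ[u]-ring = record { isCommutativeRing =
    RingMonomorphism.isCommutativeRing coeff-mono (CommutativeRing.isCommutativeRing ℚ⊛.⊛-ring) }

  constant-hom : IsRingHomomorphism ℚ.+-*-rawRing ℚ[u] constant
  constant-hom = record
    { isSemiringHomomorphism = record
      { isNearSemiringHomomorphism = record
        { +-isMonoidHomomorphism = record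
          { isMagmaHomomorphism = record
            { isRelHomomorphism = record { cong = λ { refl _ → refl } }
            ; homo = λ a b i → refl
            }
          ; ε-homo = λ { zero → refl ; (suc i) → refl }
          }
        ; *-homo = λ { a b zero → sym (ℚ.+-identityʳ (a * b)) ; a b (suc i) → refl }
        }
      ; 1#-homo = λ _ → refl
      }
    ; -‿homo = λ a i → refl
    }

  private
    module P = CommutativeRing ℚ[u]-ring
  open RawRing ℚ[u] using () renaming (_+_ to _+ᵖ_; _*_ to _*ᵖ_)
  open RawSemiringDefs (RawRing.rawSemiring ℚ[u]) using () renaming (_^_ to _^ₚ_)
  -- The general calculation is run separately for u = `var` and for u = 1, so that no substitution
  -- has to be carried through the truncated sums.
  module Fℚ[u] = Bivariate ℚ[u] P.isCommutativeRing constant constant-hom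
  module Fℚ = Bivariate ℚ.+-*-rawRing ℚ.+-*-isCommutativeRing id (Identity.isRingHomomorphism ℚ.+-*-rawRing refl)
  open RawSemiringDefs (RawRing.rawSemiring ℚ.+-*-rawRing) using (_^_)

  coeff-var-* : ∀ p i → coeff (var *ᵖ p) (suc i) ≡ coeff p i
  coeff-var-* p i = trans (coeff-* var p (suc i)) (ℚ⊛.shift-⊛-suc {coeff var} refl coeff-1 (coeff p) i)

  coeff-var-*-zero : ∀ p → coeff (var *ᵖ p) 0 ≡ 0ℚ
  coeff-var-*-zero p = trans (coeff-* var p 0) (ℚ⊛.shift-⊛-zero {coeff var} refl (coeff p))

  coeff-even+odd : ∀ a b i → coeff (P.1# *ᵖ (constant a +ᵖ var *ᵖ constant b)) i ≡ coeff (a ∷ b ∷ []) i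
  coeff-even+odd a b i = trans (P.*-identityˡ (constant a +ᵖ var *ᵖ constant b) i)
    (trans (coeff-+ (constant a) (var *ᵖ constant b) i) (go i))
    where
    go : ∀ i → coeff (constant a) i + coeff (var *ᵖ constant b) i ≡ coeff (a ∷ b ∷ []) i
    go zero    = trans (cong (λ z → a + z) (coeff-var-*-zero (constant b))) (ℚ.+-identityʳ a)
    go (suc i) = trans (ℚ.+-identityˡ _) (coeff-var-* (constant b) i)

  var²-Σ≤ : ℕ → (ℕ → ℚ) → Poly
  var²-Σ≤ M c = Seriesℚ[u].Σ≤ M λ m →
    (var ^ₚ 2) ^ₚ m *ᵖ (constant (c (m ℕ.* 2)) +ᵖ var *ᵖ constant (c (suc (m ℕ.* 2))))

  var²-Σ≤-suc : ∀ M c → var²-Σ≤ (suc M) c ≈ₚ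
    P.1# *ᵖ (constant (c 0) +ᵖ var *ᵖ constant (c 1)) +ᵖ var *ᵖ (var *ᵖ var²-Σ≤ M (c ∘ (2 ℕ.+_)))
  var²-Σ≤-suc M c = GeometricSum.horner ℚ[u]-ring var
    (λ m → constant (c (m ℕ.* 2)) +ᵖ var *ᵖ constant (c (suc (m ℕ.* 2)))) M

  -- Summand m occupies the degrees 2m and 2m + 1, so the sum up to M covers the degrees below 2(M +
  -- 1). The induction removes the first pair and continues with c shifted by two.
  coeff-var²-Σ≤ : ∀ M c → (∀ i → suc M ℕ.* 2 ℕ.≤ i → c i ≡ 0ℚ) → ∀ i → coeff (var²-Σ≤ M c) i ≡ c i
  coeff-var²-Σ≤ zero c c≡0 i = trans (P.+-identityʳ (P.1# *ᵖ (constant (c 0) +ᵖ var *ᵖ constant (c 1))) i)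
    (trans (coeff-even+odd (c 0) (c 1) i) (go i))
    where
    go : ∀ i → coeff (c 0 ∷ c 1 ∷ []) i ≡ c i
    go 0             = refl
    go 1             = refl
    go (suc (suc i)) = sym (c≡0 (suc (suc i)) (ℕ.s≤s (ℕ.s≤s ℕ.z≤n)))
  coeff-var²-Σ≤ (suc M) c c≡0 i = begin
    coeff (var²-Σ≤ (suc M) c) i
      ≡⟨ var²-Σ≤-suc M c i ⟩
    coeff (h +ᵖ var *ᵖ (var *ᵖ s)) i
      ≡⟨ coeff-+ h (var *ᵖ (var *ᵖ s)) i ⟩
    coeff h i + coeff (var *ᵖ (var *ᵖ s)) i
      ≡⟨ cong (_+ coeff (var *ᵖ (var *ᵖ s)) i) (coeff-even+odd (c 0) (c 1) i) ⟩
    coeff (c 0 ∷ c 1 ∷ []) i + coeff (var *ᵖ (var *ᵖ s)) i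
      ≡⟨ go i ⟩
    c i ∎
    where
    open ≡-Reasoning
    h = P.1# *ᵖ (constant (c 0) +ᵖ var *ᵖ constant (c 1))
    s = var²-Σ≤ M (c ∘ (2 ℕ.+_))
    go : ∀ i → coeff (c 0 ∷ c 1 ∷ []) i + coeff (var *ᵖ (var *ᵖ s)) i ≡ c i
    go 0             = trans (cong (λ z → c 0 + z) (coeff-var-*-zero (var *ᵖ s))) (ℚ.+-identityʳ (c 0))
    go 1             = trans (cong (λ z → c 1 + z) (trans (coeff-var-* (var *ᵖ s) 0) (coeff-var-*-zero s))) (ℚ.+-identityʳ (c 1))
    go (suc (suc i)) = trans (ℚ.+-identityˡ _) (trans (coeff-var-* (var *ᵖ s) (suc i)) (trans (coeff-var-* s i)
      (coeff-var²-Σ≤ M (c ∘ (2 ℕ.+_)) (λ j le → c≡0 (suc (suc j)) (ℕ.s≤s (ℕ.s≤s le))) i)))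

  -- Each summand has a factor counting surjections onto ⌊ℓ/2⌋ + 1 points, which are more than
  -- either part has.
  pathCount-≥ : ∀ n k ℓ → suc (n ℕ.+ k) ℕ.* 2 ℕ.≤ ℓ → pathCount n k ℓ ≡ 0
  pathCount-≥ n k ℓ le = cong₂ ℕ._+_
    (cong (ℕ._* surjections k ⌈ ℓ /2⌉) (surjections-< (ℕ.≤-<-trans (ℕ.m≤m+n n k) bound)))
    (trans (cong (surjections n ⌈ ℓ /2⌉ ℕ.*_) (surjections-< (ℕ.≤-<-trans (ℕ.m≤n+m k n) bound)))
      (ℕ.*-zeroʳ (surjections n ⌈ ℓ /2⌉)))
    where
    bound : n ℕ.+ k ℕ.< suc ⌊ ℓ /2⌋
    bound = ℕ.m<n⇒m<1+n (≡.subst (ℕ._≤ ⌊ ℓ /2⌋) (⌊m*2/2⌋≡m (suc (n ℕ.+ k))) (ℕ.⌊n/2⌋-mono le))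

  coeff-coeffF : ∀ n k → 0 ≢ n ℕ.+ k → ∀ ℓ → coeff (coeffF n k) ℓ ≡ pathWeight n k ℓ
  coeff-coeffF n k 0≢ ℓ = trans (Fℚ[u].F-coefficient var n k 0≢ ℓ)
    (coeff-var²-Σ≤ (n ℕ.+ k) (pathWeight n k)
      (λ i le → trans (cong (λ c → fromℕ c * (1/ n ! * 1/ k !)) (pathCount-≥ n k i le)) (ℚ.*-zeroˡ (1/ n ! * 1/ k !))) ℓ)

  1²^m≡1 : ∀ m → (1ℚ ^ 2) ^ m ≡ 1ℚ
  1²^m≡1 zero    = refl
  1²^m≡1 (suc m) = cong ((1ℚ ^ 2) *_) (1²^m≡1 m)

  Σ≤-weights : ∀ M (c : ℕ → ℕ) w →
    Seriesℚ.Σ≤ M (λ m → (1ℚ ^ 2) ^ m * (fromℕ (c (m ℕ.* 2)) * w + 1ℚ * (fromℕ (c (suc (m ℕ.* 2))) * w)))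
    ≡ fromℕ (ℕ.sum (applyUpTo c (suc M ℕ.* 2))) * w
  Σ≤-weights M c w = trans
    (SemiringSum.sum-cong-≋ (CommutativeRing.semiring ℚ.+-*-commutativeRing) {suc M} (λ i → simplify (toℕ i)))
    (go M c)
    where
    open ≡-Reasoning
    simplify : ∀ m → (1ℚ ^ 2) ^ m * (fromℕ (c (m ℕ.* 2)) * w + 1ℚ * (fromℕ (c (suc (m ℕ.* 2))) * w))
               ≡ fromℕ (c (m ℕ.* 2) ℕ.+ c (suc (m ℕ.* 2))) * w
    simplify m = begin
      (1ℚ ^ 2) ^ m * (a * w + 1ℚ * (b * w))
        ≡⟨ cong₂ _*_ (1²^m≡1 m) (cong (λ z → a * w + z) (ℚ.*-identityˡ (b * w))) ⟩
      1ℚ * (a * w + b * w)                   ≡⟨ ℚ.*-identityˡ _ ⟩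
      a * w + b * w                          ≡⟨ ℚ.*-distribʳ-+ w a b ⟨
      (a + b) * w                            ≡⟨ cong (_* w) (×-homo-+ 1ℚ (c (m ℕ.* 2)) (c (suc (m ℕ.* 2)))) ⟨
      fromℕ (c (m ℕ.* 2) ℕ.+ c (suc (m ℕ.* 2))) * w ∎
      where
      a = fromℕ (c (m ℕ.* 2))
      b = fromℕ (c (suc (m ℕ.* 2)))
    go : ∀ M c → Seriesℚ.Σ≤ M (λ m → fromℕ (c (m ℕ.* 2) ℕ.+ c (suc (m ℕ.* 2))) * w) ≡ fromℕ (ℕ.sum (applyUpTo c (suc M ℕ.* 2))) * w
    go zero    c = trans (ℚ.+-identityʳ _) (cong (λ s → fromℕ (c 0 ℕ.+ s) * w) (sym (ℕ.+-identityʳ (c 1))))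
    go (suc M) c = begin
      fromℕ (c 0 ℕ.+ c 1) * w + _           ≡⟨ cong (λ z → fromℕ (c 0 ℕ.+ c 1) * w + z) (go M (c ∘ (2 ℕ.+_))) ⟩
      fromℕ (c 0 ℕ.+ c 1) * w + fromℕ r * w ≡⟨ ℚ.*-distribʳ-+ w (fromℕ (c 0 ℕ.+ c 1)) (fromℕ r) ⟨
      (fromℕ (c 0 ℕ.+ c 1) + fromℕ r) * w   ≡⟨ cong (_* w) (×-homo-+ 1ℚ (c 0 ℕ.+ c 1) r) ⟨
      fromℕ (c 0 ℕ.+ c 1 ℕ.+ r) * w         ≡⟨ cong (λ s → fromℕ s * w) (ℕ.+-assoc (c 0) (c 1) r) ⟩
      fromℕ (c 0 ℕ.+ (c 1 ℕ.+ r)) * w       ∎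
      where r = ℕ.sum (applyUpTo (c ∘ (2 ℕ.+_)) (suc M ℕ.* 2))

  coeffF₁-total : ∀ n k → 0 ≢ n ℕ.+ k →
    coeffF₁ n k ≡ fromℕ (ℕ.sum (applyUpTo (pathCount n k) (suc (n ℕ.+ k) ℕ.* 2))) * (1/ n ! * 1/ k !)
  coeffF₁-total n k 0≢ = trans (Fℚ.F-coefficient 1ℚ n k 0≢) (Σ≤-weights (n ℕ.+ k) (pathCount n k) (1/ n ! * 1/ k !))

  fromℕ≢0 : ∀ b .{{_ : ℕ.NonZero b}} → fromℕ b ≢ 0ℚ
  fromℕ≢0 b eq = ℚ.1≢0 (begin
    1ℚ                         ≡⟨ /-fromℕ 1 b ⟨
    (+ 1 ℚ./ b) * fromℕ b      ≡⟨ cong ((+ 1 ℚ./ b) *_) eq ⟩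
    (+ 1 ℚ./ b) * 0ℚ           ≡⟨ ℚ.*-zeroʳ (+ 1 ℚ./ b) ⟩
    0ℚ                         ∎)
    where open ≡-Reasoning

  weighted≢0 : ∀ n k b .{{_ : ℕ.NonZero b}} → fromℕ b * (1/ n ! * 1/ k !) ≢ 0ℚ
  weighted≢0 n k b eq = fromℕ≢0 b (begin
    fromℕ b                                          ≡⟨ ℚ.*-identityʳ (fromℕ b) ⟨
    fromℕ b * (1ℚ * 1ℚ)
      ≡⟨ cong (fromℕ b *_) (cong₂ _*_ (/-fromℕ 1 (n !) {{n ℕ.!≢0}}) (/-fromℕ 1 (k !) {{k ℕ.!≢0}})) ⟨
    fromℕ b * ((p * fromℕ (n !)) * (q * fromℕ (k !)))
      ≡⟨ solve 5 (λ b p x q y → b :* ((p :* x) :* (q :* y)) := (b :* (p :* q)) :* (x :* y))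
           refl (fromℕ b) p (fromℕ (n !)) q (fromℕ (k !)) ⟩
    (fromℕ b * (p * q)) * (fromℕ (n !) * fromℕ (k !)) ≡⟨ cong (_* (fromℕ (n !) * fromℕ (k !))) eq ⟩
    0ℚ * (fromℕ (n !) * fromℕ (k !))                 ≡⟨ ℚ.*-zeroˡ (fromℕ (n !) * fromℕ (k !)) ⟩
    0ℚ                                               ∎)
    where
    open ≡-Reasoning
    open ℚSolver using (solve; _:=_; _:*_)
    p = 1/ n !
    q = 1/ k !

  -- Here the weight w = 1/(n! k!) cancels: c is the count for one length, b the count of all
  -- acyclic orientations and f the coefficient of F at u = 1.
  ratio : ∀ c b .{{_ : ℕ.NonZero b}} w {f} .{{_ : ℚ.NonZero f}} → f ≡ fromℕ b * w → + c ℚ./ b ≡ ℚ.1/ f * (fromℕ c * w)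
  ratio c b w {f} f≡ = begin
    c/b                             ≡⟨ ℚ.*-identityˡ c/b ⟨
    1ℚ * c/b                        ≡⟨ cong (_* c/b) (ℚ.*-inverseˡ f) ⟨
    ℚ.1/ f * f * c/b                ≡⟨ ℚ.*-assoc (ℚ.1/ f) f c/b ⟩
    ℚ.1/ f * (f * c/b)              ≡⟨ cong (λ z → ℚ.1/ f * (z * c/b)) f≡ ⟩
    ℚ.1/ f * (fromℕ b * w * c/b)
      ≡⟨ cong (ℚ.1/ f *_) (solve 3 (λ b w r → b :* w :* r := r :* b :* w) refl (fromℕ b) w c/b) ⟩
    ℚ.1/ f * (c/b * fromℕ b * w)    ≡⟨ cong (λ z → ℚ.1/ f * (z * w)) (/-fromℕ c b) ⟩
    ℚ.1/ f * (fromℕ c * w)          ∎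
    where
    open ≡-Reasoning
    open ℚSolver using (solve; _:=_; _:*_)
    c/b = + c ℚ./ b

open Coefficients

-- Acyclic orientations and their longest paths

module Orientations where
  open ≡ using (refl; sym; trans; cong; cong₂; subst; subst₂; module ≡-Reasoning)

  -- Counting

  unique-lookup-injective : ∀ {A : Set} {xs : List A} → Unique xs → ∀ {i j} → List.lookup xs i ≡ List.lookup xs j → i ≡ j
  unique-lookup-injective (_ ∷ _)  {zero}  {zero}  _  = refl
  unique-lookup-injective (x≢ ∷ _) {zero}  {suc j} eq = contradiction eq (ListAll.lookup x≢ (∈-lookup j))
  unique-lookup-injective (x≢ ∷ _) {suc i} {zero}  eq = contradiction (sym eq) (ListAll.lookup x≢ (∈-lookup i))
  unique-lookup-injective (_ ∷ u)  {suc i} {suc j} eq = cong suc (unique-lookup-injective u eq)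

  -- A bijection given as a relation: no inverse maps have to be defined on list members together
  -- with their membership proofs. Totality with left uniqueness and surjectivity with right
  -- uniqueness yield one injection each way between finite sets.
  length-≡ : ∀ {A B : Set} {N} {xs : List A} (_∼_ : A → B → Set) → Unique xs → B ↔ Fin N →
    (∀ {x} → x ∈ xs → ∃ λ y → x ∼ y) →
    (∀ y → ∃ λ x → x ∈ xs × x ∼ y) →
    (∀ {x x′ y} → x ∼ y → x′ ∼ y → x ≡ x′) →
    (∀ {x y y′} → x ∼ y → x ∼ y′ → y ≡ y′) →
    length xs ≡ N
  length-≡ {xs = xs} _∼_ unique B↔Fin total onto left-unique right-unique =
    ℕ.≤-antisym (Fin.injective⇒≤ f-injective) (Fin.injective⇒≤ g-injective)
    where
    open Inverse B↔Fin using (to; from; strictlyInverseʳ; strictlyInverseˡ)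

    f : Fin (length xs) → Fin _
    f i = to (proj₁ (total (∈-lookup i)))

    f-injective : ∀ {i j} → f i ≡ f j → i ≡ j
    f-injective {i} {j} eq = unique-lookup-injective unique
      (left-unique (proj₂ (total (∈-lookup i))) (subst (List.lookup xs j ∼_) (sym y≡y′) (proj₂ (total (∈-lookup j)))))
      where
      y≡y′ : proj₁ (total (∈-lookup i)) ≡ proj₁ (total (∈-lookup j))
      y≡y′ = trans (sym (strictlyInverseʳ _)) (trans (cong from eq) (strictlyInverseʳ _))

    g : Fin _ → Fin (length xs)
    g i = Any.index (proj₁ (proj₂ (onto (from i))))

    g-injective : ∀ {i j} → g i ≡ g j → i ≡ j
    g-injective {i} {j} eq with onto (from i) | onto (from j)
    ... | x , x∈ , x∼ | x′ , x′∈ , x′∼ = trans (sym (strictlyInverseˡ i)) (trans (cong to from-eq) (strictlyInverseˡ j))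
      where
      x≡x′ : x ≡ x′
      x≡x′ = trans (lookup-index x∈) (trans (cong (List.lookup xs) eq) (sym (lookup-index x′∈)))
      from-eq : from i ≡ from j
      from-eq = right-unique x∼ (subst (_∼ from j) (sym x≡x′) x′∼)

  indicator : ∀ {P : Set} → Dec P → ℕ
  indicator (yes _) = 1
  indicator (no _)  = 0

  length-filter-∷ : ∀ {A : Set} {P : A → Set} (P? : Unary.Decidable P) x xs →
    length (filter P? (x ∷ xs)) ≡ indicator (P? x) ℕ.+ length (filter P? xs)
  length-filter-∷ P? x xs with P? x
  ... | yes _ = refl
  ... | no _  = refl

  sum-applyUpTo-+ : ∀ (f g : ℕ → ℕ) b → ℕ.sum (applyUpTo (λ i → f i ℕ.+ g i) b) ≡ ℕ.sum (applyUpTo f b) ℕ.+ ℕ.sum (applyUpTo g b)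
  sum-applyUpTo-+ f g zero    = refl
  sum-applyUpTo-+ f g (suc b) = trans (cong (f 0 ℕ.+ g 0 ℕ.+_) (sum-applyUpTo-+ (f ∘ suc) (g ∘ suc) b))
    (solve 4 (λ a b c d → (a :+ b) :+ (c :+ d) := (a :+ c) :+ (b :+ d)) refl (f 0) (g 0) _ _)
    where
    open +-*-Solver using (solve; _:=_; _:+_)

  sum-applyUpTo-cong : ∀ {f g : ℕ → ℕ} b → f ≗ g → ℕ.sum (applyUpTo f b) ≡ ℕ.sum (applyUpTo g b)
  sum-applyUpTo-cong zero    f≗g = refl
  sum-applyUpTo-cong (suc b) f≗g = cong₂ ℕ._+_ (f≗g 0) (sum-applyUpTo-cong b (f≗g ∘ suc))

  sum-applyUpTo-0 : ∀ {f : ℕ → ℕ} b → (∀ i → f i ≡ 0) → ℕ.sum (applyUpTo f b) ≡ 0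
  sum-applyUpTo-0 zero    f≡0 = refl
  sum-applyUpTo-0 (suc b) f≡0 = cong₂ ℕ._+_ (f≡0 0) (sum-applyUpTo-0 b (f≡0 ∘ suc))

  sum-indicators : ∀ {P : ℕ → Set} (P? : Unary.Decidable P) (unique : ∀ {i j} → P i → P j → i ≡ j) →
    ∀ {m} b → P m → m < b → ℕ.sum (applyUpTo (indicator ∘ P?) b) ≡ 1
  sum-indicators P? unique {zero} (suc b) pm _ with P? 0
  ... | no ¬p = contradiction pm ¬p
  ... | yes _ = cong suc (sum-applyUpTo-0 b zeros)
    where
    zeros : ∀ i → indicator (P? (suc i)) ≡ 0
    zeros i with P? (suc i)
    ... | no _  = refl
    ... | yes p with () ← unique pm p
  sum-indicators P? unique {suc m} (suc b) pm (s≤s m<b) with P? 0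
  ... | yes p with () ← unique p pm
  ... | no _ = sum-indicators (P? ∘ suc) (λ p q → ℕ.suc-injective (unique p q)) b pm m<b

  length-partition : ∀ {A : Set} {P : ℕ → A → Set} (P? : ∀ i → Unary.Decidable (P i)) →
    (∀ {x i j} → P i x → P j x → i ≡ j) → ∀ b xs → (∀ {x} → x ∈ xs → ∃ λ i → P i x × i < b) →
    length xs ≡ ℕ.sum (applyUpTo (λ i → length (filter (P? i) xs)) b)
  length-partition P? unique b []       class = sym (sum-applyUpTo-0 b (λ _ → refl))
  length-partition P? unique b (x ∷ xs) class = sym (begin
    ℕ.sum (applyUpTo (λ i → length (filter (P? i) (x ∷ xs))) b)
      ≡⟨ sum-applyUpTo-cong b (λ i → length-filter-∷ (P? i) x xs) ⟩
    ℕ.sum (applyUpTo (λ i → indicator (P? i x) ℕ.+ length (filter (P? i) xs)) b)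
      ≡⟨ sum-applyUpTo-+ (λ i → indicator (P? i x)) (λ i → length (filter (P? i) xs)) b ⟩
    ℕ.sum (applyUpTo (λ i → indicator (P? i x)) b) ℕ.+ ℕ.sum (applyUpTo (λ i → length (filter (P? i) xs)) b)
      -- The head lies in exactly one class, so its indicators add up to 1.
      ≡⟨ cong₂ ℕ._+_ (let _ , p , i<b = class (here refl) in sum-indicators (λ i → P? i x) unique b p i<b)
                     (sym (length-partition P? unique b xs (class ∘ there))) ⟩
    suc (length xs) ∎)
    where open ≡-Reasoning

  -- Surjections

  Surjective : ∀ {n m} → (Fin n → Fin m) → Set
  Surjective f = ∀ y → ∃ λ i → f i ≡ y

  -- A surjection as first-order data, shaped like the recurrence of `surjections`. Its cardinality
  -- is then immediate, and codes can be compared by `≡` where functions are only compared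
  -- pointwise.
  Code : ℕ → ℕ → Set
  Code zero    zero    = ⊤
  Code zero    (suc m) = ⊥
  Code (suc n) zero    = ⊥
  Code (suc n) (suc m) = Fin (suc m) × (Code n m ⊎ Code n (suc m))

  -- The first value of a surjection is either taken only once or taken again later.
  decode : ∀ {n m} → Code n m → Fin n → Fin m
  decode {suc n} {suc m} (c , _)      zero    = c
  decode {suc n} {suc m} (c , inj₁ w) (suc i) = punchIn c (decode w i)
  decode {suc n} {suc m} (c , inj₂ w) (suc i) = decode w i

  Code↔Fin : ∀ n m → Code n m ↔ Fin (surjections n m)
  Code↔Fin zero    zero    = mk↔ₛ′ (λ _ → zero) (λ _ → tt) (λ { zero → refl }) (λ _ → refl)
  Code↔Fin zero    (suc m) = mk↔ₛ′ (λ ()) (λ ()) (λ ()) (λ ())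
  Code↔Fin (suc n) zero    = mk↔ₛ′ (λ ()) (λ ()) (λ ()) (λ ())
  Code↔Fin (suc n) (suc m) =
    ↔-sym Fin.*↔× ↔-∘ (↔-id _ ×-↔ (↔-sym Fin.+↔⊎ ↔-∘ (Code↔Fin n m ⊎-↔ Code↔Fin n (suc m))))

  decode-surjective : ∀ {n m} (w : Code n m) → Surjective (decode w)
  decode-surjective {zero}  {zero}  _            ()
  decode-surjective {suc n} {suc m} (c , inj₁ w) y with c Fin.≟ y
  ... | yes c≡y = zero , c≡y
  ... | no  c≢y = let i , eq = decode-surjective w (punchOut c≢y)
                  in suc i , trans (cong (punchIn c) eq) (Fin.punchIn-punchOut c≢y)
  decode-surjective {suc n} {suc m} (c , inj₂ w) y = let i , eq = decode-surjective w y in suc i , eq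

  decode-injective : ∀ {n m} (w w′ : Code n m) → decode w ≗ decode w′ → w ≡ w′
  decode-injective {zero}  {zero}  _ _ _ = refl
  decode-injective {suc n} {suc m} (c , x) (c′ , x′) eq with refl ← eq zero = cong (c ,_) (go x x′ (eq ∘ suc))
    where
    go : ∀ x x′ → (∀ i → decode {suc n} {suc m} (c , x) (suc i) ≡ decode {suc n} {suc m} (c , x′) (suc i)) → x ≡ x′
    go (inj₁ w) (inj₁ w′) eq = cong inj₁ (decode-injective w w′ (λ i → Fin.punchIn-injective c _ _ (eq i)))
    go (inj₂ w) (inj₂ w′) eq = cong inj₂ (decode-injective w w′ eq)
    -- One code says that the value c does not recur, the other that it does: `punchIn c` avoids c,
    -- whereas a surjection hits it.
    go (inj₁ w) (inj₂ w′) eq = let i , hit = decode-surjective w′ c in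
      contradiction (trans (eq i) hit) (Fin.punchInᵢ≢i c _)
    go (inj₂ w) (inj₁ w′) eq = let i , hit = decode-surjective w c in
      contradiction (trans (sym (eq i)) hit) (Fin.punchInᵢ≢i c _)

  encode : ∀ {n m} (f : Fin n → Fin m) → Surjective f → ∃ λ (w : Code n m) → decode w ≗ f
  encode {zero}  {zero}  f sur = tt , λ ()
  encode {zero}  {suc m} f sur with () ← proj₁ (sur zero)
  encode {suc n} {zero}  f sur with () ← f zero
  encode {suc n} {suc m} f sur with Fin.any? (λ i → f (suc i) Fin.≟ f zero)
  ... | yes (i₀ , hit) = let w , eq = encode (f ∘ suc) sur′ in (f zero , inj₂ w) , λ { zero → refl ; (suc i) → eq i }
    where
    sur′ : Surjective (f ∘ suc)
    sur′ y with sur y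
    ... | zero  , eq = i₀ , trans hit eq
    ... | suc i , eq = i , eq
  ... | no miss = let w , eq = encode g sur′ in
      (f zero , inj₁ w) , λ { zero → refl ; (suc i) → trans (cong (punchIn (f zero)) (eq i)) (Fin.punchIn-punchOut (avoid i)) }
    where
    avoid : ∀ i → f zero ≢ f (suc i)
    avoid i eq = miss (i , sym eq)
    g : Fin n → Fin m
    g i = punchOut (avoid i)
    sur′ : Surjective g
    sur′ y with sur (punchIn (f zero) y)
    ... | zero  , eq = contradiction (sym eq) (Fin.punchInᵢ≢i (f zero) y)
    ... | suc i , eq = i , Fin.punchIn-injective (f zero) _ _ (trans (Fin.punchIn-punchOut (avoid i)) eq)

  -- Rankings

  module _ {V : Set} (_⟶_ : Rel V 0ℓ) where

    -- The function "length of the longest path from v" described without paths: `decreasing` makes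
    -- it large enough and `successor` prevents it from being larger. By `ranking-unique` these
    -- local conditions determine it.
    record IsRanking (h : V → ℕ) (ℓ : ℕ) : Set where
      field
        bounded    : ∀ v → h v ≤ ℓ
        onto       : ∀ {d} → d ≤ ℓ → ∃ λ v → h v ≡ d
        decreasing : ∀ {v w} → v ⟶ w → h w < h v
        successor  : ∀ {v d} → h v ≡ suc d → ∃ λ w → v ⟶ w × h w ≡ d

    -- Walks may repeat vertices, which makes them easy to extend and shorten. In an acyclic graph
    -- `walk⇒path` supplies the distinctness.
    Walk : ℕ → V → Set
    Walk zero    v = ⊤
    Walk (suc d) v = ∃ λ w → v ⟶ w × Walk d w

    walk-shorten-≤ : ∀ {d e v} → d ≤ e → Walk e v → Walk d v
    walk-shorten-≤ z≤n       _           = tt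
    walk-shorten-≤ (s≤s d≤e) (w , a , ω) = w , a , walk-shorten-≤ d≤e ω

    linked⇒walk : ∀ {d} {vs : Vec V (suc d)} → Linked _⟶_ vs → Walk d (head vs)
    linked⇒walk {vs = _ ∷ []}     [-]      = tt
    linked⇒walk {vs = _ ∷ _ ∷ _} (a ∷ as) = _ , a , linked⇒walk as

    walk⇒linked : ∀ d {v} → Walk d v → ∃ λ (vs : Vec V (suc d)) → Linked _⟶_ vs × head vs ≡ v
    walk⇒linked zero    {v} _           = v ∷ [] , [-] , refl
    walk⇒linked (suc d) {v} (w , a , ω) with walk⇒linked d ω
    ... | vs , as , refl = v ∷ vs , a ∷ as , refl

    -- The last component hands freshness of a vertex down to the prefix, so that the recursion
    -- keeps the vertices distinct when it puts the head back.
    path-prefix : ∀ {d} {vs : Vec V (suc d)} → IsDirectedPath _⟶_ vs → ∀ i →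
      ∃ λ e → ∃ λ (us : Vec V (suc e)) → IsDirectedPath _⟶_ us × head us ≡ head vs × last us ≡ lookup vs i ×
        (∀ x → VecAll.All (x ≢_) vs → VecAll.All (x ≢_) us)
    path-prefix {vs = v ∷ _} _ zero = 0 , v ∷ [] , isPath [-] ([] ∷ []) , refl , refl , λ { x (x≢v ∷ _) → x≢v ∷ [] }
    path-prefix {vs = v ∷ _ ∷ _} (isPath (a ∷ as) (v∉ ∷ distinct)) (suc i) with path-prefix (isPath as distinct) i
    ... | e , us , isPath bs distinct′ , refl , last≡ , fresh =
      suc e , v ∷ us , isPath (a ∷ bs) (fresh v v∉ ∷ distinct′) , refl , last≡ , λ { x (x≢v ∷ x∉) → x≢v ∷ fresh x x∉ }

    -- If the first vertex recurs, the walk from its second vertex up to the recurrence closes up to a cycle.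
    linked-unique : Acyclic _⟶_ → ∀ {d} {vs : Vec V (suc d)} → Linked _⟶_ vs → Vec.Unique vs
    linked-unique acyclic {vs = _ ∷ []}     _        = [] ∷ []
    linked-unique acyclic {vs = v ∷ ws@(_ ∷ _)} (a ∷ as) = VecAll.lookup⁻ fresh ∷ distinct
      where
      distinct = linked-unique acyclic as
      fresh : ∀ i → v ≢ lookup ws i
      fresh i v≡ with path-prefix (isPath as distinct) i
      ... | e , us , path , head≡ , last≡ , _ = acyclic
        (e , us , path , subst (_⟶ head us) (trans v≡ (sym last≡)) (subst (v ⟶_) (sym head≡) a))

    walk⇒path : Acyclic _⟶_ → ∀ {d v} → Walk d v → HasPathOfLength _⟶_ d
    walk⇒path acyclic {d} ω = let vs , as , _ = walk⇒linked d ω in vs , isPath as (linked-unique acyclic as)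

    module _ {h : V → ℕ} (decreasing : ∀ {v w} → v ⟶ w → h w < h v) where

      decreasing-linked : ∀ {d} {vs : Vec V (suc d)} → Linked _⟶_ vs → d ℕ.+ h (last vs) ≤ h (head vs)
      decreasing-linked {vs = _ ∷ []}     [-]      = ℕ.≤-refl
      decreasing-linked {vs = _ ∷ _ ∷ _} (a ∷ as) = ℕ.≤-trans (s≤s (decreasing-linked as)) (decreasing a)

      decreasing⇒acyclic : Acyclic _⟶_
      decreasing⇒acyclic (d , vs , isPath as _ , a) =
        ℕ.<⇒≱ (decreasing a) (ℕ.≤-trans (ℕ.m≤n+m (h (last vs)) d) (decreasing-linked as))

    module _ {h ℓ} (ranking : IsRanking h ℓ) where
      open IsRanking ranking

      ranking-walk : ∀ d {v} → h v ≡ d → Walk d v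
      ranking-walk zero    _  = tt
      ranking-walk (suc d) eq = let w , a , eq′ = successor eq in w , a , ranking-walk d eq′

      ranking⇒longest : LongestPathHasLength _⟶_ ℓ
      ranking⇒longest =
        walk⇒path (decreasing⇒acyclic decreasing) (ranking-walk ℓ (proj₂ (onto ℕ.≤-refl))) ,
        λ { m (vs , isPath as _) → ℕ.≤-trans (ℕ.m≤m+n m (h (last vs)))
              (ℕ.≤-trans (decreasing-linked decreasing as) (bounded (head vs))) }

      -- Following `successor` from v gives a descent of `h v` arcs, and h′ must drop along each of
      -- them. A ranking is thus the least decreasing function, hence unique.
      ranking-≤ : ∀ {h′ : V → ℕ} → (∀ {v w} → v ⟶ w → h′ w < h′ v) → ∀ v → h v ≤ h′ v
      ranking-≤ {h′} decreasing′ v = go (h v) refl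
        where
        go : ∀ d {v} → h v ≡ d → d ≤ h′ v
        go zero    _  = z≤n
        go (suc d) eq = let w , a , eq′ = successor eq in ℕ.≤-<-trans (go d eq′) (decreasing′ a)

    ranking-unique : ∀ {h h′ ℓ ℓ′} → IsRanking h ℓ → IsRanking h′ ℓ′ → h ≗ h′
    ranking-unique r r′ v = ℕ.≤-antisym
      (ranking-≤ r (IsRanking.decreasing r′) v) (ranking-≤ r′ (IsRanking.decreasing r) v)

    longest-unique : ∀ {ℓ ℓ′} → LongestPathHasLength _⟶_ ℓ → LongestPathHasLength _⟶_ ℓ′ → ℓ ≡ ℓ′
    longest-unique (p , max) (p′ , max′) = ℕ.≤-antisym (max′ _ p) (max _ p′)

    -- P need not be monotone, so this only finds a change from true to false. For walks it is the
    -- maximum, since `walk-shorten-≤` spreads the failure at r + 1 to all greater lengths.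
    last-true : ∀ {P : ℕ → Set} → Unary.Decidable P → P 0 → ∀ b → ¬ P b → ∃ λ r → P r × ¬ P (suc r)
    last-true P? p₀ zero    ¬p₀ = contradiction p₀ ¬p₀
    last-true P? p₀ (suc b) ¬pb with P? b
    ... | yes p = b , p , ¬pb
    ... | no ¬p = last-true P? p₀ b ¬p

    module _ (walk? : ∀ d → Unary.Decidable (Walk d)) {b : ℕ} (acyclic : Acyclic _⟶_)
             (short : ∀ d → HasPathOfLength _⟶_ d → d < b) where

      private
        longestWalk : ∀ v → ∃ λ r → Walk r v × ¬ Walk (suc r) v
        longestWalk v = last-true (λ d → walk? d v) tt b (λ ω → ℕ.<-irrefl refl (short b (walk⇒path acyclic ω)))

      rank : V → ℕ
      rank v = proj₁ (longestWalk v)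

      rank-walk : ∀ v → Walk (rank v) v
      rank-walk v = proj₁ (proj₂ (longestWalk v))

      rank-max : ∀ {d} v → Walk d v → d ≤ rank v
      rank-max v ω = ℕ.≮⇒≥ λ r<d → proj₂ (proj₂ (longestWalk v)) (walk-shorten-≤ r<d ω)

      rank-decreasing : ∀ {v w} → v ⟶ w → rank w < rank v
      rank-decreasing {v} {w} a = rank-max v (w , a , rank-walk w)

      rank-successor : ∀ {v d} → rank v ≡ suc d → ∃ λ w → v ⟶ w × rank w ≡ d
      rank-successor {v} {d} eq =
        let w , a , ω = subst (λ r → Walk r v) eq (rank-walk v)
        -- The rest of the walk gives rank w at least d, and the arc from v gives at most d.
        in w , a , ℕ.≤-antisym (ℕ.s≤s⁻¹ (subst (rank w <_) eq (rank-decreasing a))) (rank-max w ω)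

      rank-isRanking : ∀ {ℓ} → LongestPathHasLength _⟶_ ℓ → IsRanking rank ℓ
      rank-isRanking {ℓ} ((vs , isPath as _) , longest) = record
        { bounded    = bounded
        -- The start of a longest path has rank ℓ, and ℓ - d successor steps lead from it down to
        -- rank d.
        ; onto       = λ {d} d≤ℓ → descend (ℓ ℕ.∸ d) (head vs)
            (trans (ℕ.≤-antisym (bounded (head vs)) (rank-max (head vs) (linked⇒walk as))) (sym (ℕ.m∸n+n≡m d≤ℓ)))
        ; decreasing = rank-decreasing
        ; successor  = rank-successor
        }
        where
        bounded : ∀ v → rank v ≤ ℓ
        bounded v = longest (rank v) (walk⇒path acyclic (rank-walk v))
        descend : ∀ e {d} v → rank v ≡ e ℕ.+ d → ∃ λ w → rank w ≡ d
        descend zero    v eq = v , eq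
        descend (suc e) v eq = let w , _ , eq′ = rank-successor eq in descend e w eq′

      longest-exists : (∀ d → Dec (∃ (Walk d))) → V → ∃ λ ℓ → LongestPathHasLength _⟶_ ℓ × ℓ < b
      longest-exists someWalk? v₀ =
        let ℓ , (_ , ω) , ¬longer = last-true someWalk? (v₀ , tt) b
              (λ { (v , ω) → ℕ.<-irrefl refl (short b (walk⇒path acyclic ω)) })
            path = walk⇒path acyclic ω
        in ℓ , (path , λ { m (vs , isPath as _) → ℕ.≮⇒≥ λ ℓ<m → ¬longer (head vs , walk-shorten-≤ ℓ<m (linked⇒walk as)) })
             , short ℓ path

  -- Layerings

  Even Odd : ℕ → Set
  Even d = ∃ λ y → d ≡ y ℕ.* 2
  Odd  d = ∃ λ y → d ≡ suc (y ℕ.* 2)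

  even-or-odd : ∀ d → Even d ⊎ Odd d
  even-or-odd zero    = inj₁ (0 , refl)
  even-or-odd (suc d) with even-or-odd d
  ... | inj₁ (y , eq) = inj₂ (y , cong suc eq)
  ... | inj₂ (y , eq) = inj₁ (suc y , cong suc eq)

  even≢odd : ∀ x y → x ℕ.* 2 ≢ suc (y ℕ.* 2)
  even≢odd (suc x) (suc y) eq = even≢odd x y (ℕ.suc-injective (ℕ.suc-injective eq))

  even⇒¬odd : ∀ {d} → Even d → ¬ Odd d
  even⇒¬odd (x , d≡) (y , d≡′) = even≢odd x y (trans (sym d≡) d≡′)

  ⌊n/2⌋*2≤n : ∀ n → ⌊ n /2⌋ ℕ.* 2 ≤ n
  ⌊n/2⌋*2≤n zero          = z≤n
  ⌊n/2⌋*2≤n (suc zero)    = z≤n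
  ⌊n/2⌋*2≤n (suc (suc n)) = s≤s (s≤s (⌊n/2⌋*2≤n n))

  y*2≤ℓ⇒y≤⌊ℓ/2⌋ : ∀ {y ℓ} → y ℕ.* 2 ≤ ℓ → y < suc ⌊ ℓ /2⌋
  y*2≤ℓ⇒y≤⌊ℓ/2⌋ {y} {ℓ} le = s≤s (subst (_≤ ⌊ ℓ /2⌋) (⌊m*2/2⌋≡m y) (ℕ.⌊n/2⌋-mono le))

  y≤⌊ℓ/2⌋⇒y*2≤ℓ : ∀ {y ℓ} → y < suc ⌊ ℓ /2⌋ → y ℕ.* 2 ≤ ℓ
  y≤⌊ℓ/2⌋⇒y*2≤ℓ {y} {ℓ} (s≤s le) = ℕ.≤-trans (ℕ.*-monoˡ-≤ 2 le) (⌊n/2⌋*2≤n ℓ)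

  -- Since ⌈ℓ/2⌉ is ⌊(ℓ + 1)/2⌋ and 2y < ℓ means 2(y + 1) ≤ ℓ + 1, this is the floor version for y +
  -- 1 and ℓ + 1.
  y*2<ℓ⇒y<⌈ℓ/2⌉ : ∀ {y ℓ} → y ℕ.* 2 < ℓ → y < ⌈ ℓ /2⌉
  y*2<ℓ⇒y<⌈ℓ/2⌉ {y} {ℓ} lt = ℕ.s≤s⁻¹ (y*2≤ℓ⇒y≤⌊ℓ/2⌋ {suc y} {suc ℓ} (s≤s lt))

  y<⌈ℓ/2⌉⇒y*2<ℓ : ∀ {y ℓ} → y < ⌈ ℓ /2⌉ → y ℕ.* 2 < ℓ
  y<⌈ℓ/2⌉⇒y*2<ℓ {y} {ℓ} lt = ℕ.s≤s⁻¹ (y≤⌊ℓ/2⌋⇒y*2≤ℓ {suc y} {suc ℓ} (s≤s lt))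

  evenLevel oddLevel : ∀ {n m} → Code n m → Fin n → ℕ
  evenLevel c i = toℕ (decode c i) ℕ.* 2
  oddLevel  c i = suc (toℕ (decode c i) ℕ.* 2)

  decode-hits : ∀ {n m} (c : Code n m) {y} → y < m → ∃ λ i → toℕ (decode c i) ≡ y
  decode-hits c y<m = let i , eq = decode-surjective c (fromℕ< y<m) in i , trans (cong toℕ eq) (Fin.toℕ-fromℕ< y<m)

  encode-ℕ : ∀ {n m} (f : Fin n → ℕ) → (∀ i → f i < m) → (∀ {y} → y < m → ∃ λ i → f i ≡ y) →
    ∃ λ (c : Code n m) → ∀ i → toℕ (decode c i) ≡ f i
  encode-ℕ f f< hits =
    let c , eq = encode (λ i → fromℕ< (f< i)) λ y →
          let i , eq = hits (Fin.toℕ<n y) in i , Fin.toℕ-injective (trans (Fin.toℕ-fromℕ< (f< i)) eq)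
    in c , λ i → trans (cong toℕ (eq i)) (Fin.toℕ-fromℕ< (f< i))

  encode-even : ∀ {n ℓ} (h : Fin n → ℕ) → (∀ i → Even (h i)) → (∀ i → h i ≤ ℓ) →
    (∀ y → y ℕ.* 2 ≤ ℓ → ∃ λ i → h i ≡ y ℕ.* 2) → ∃ λ (c : Code n (suc ⌊ ℓ /2⌋)) → evenLevel c ≗ h
  encode-even {ℓ = ℓ} h even h≤ℓ onto =
    let c , eq = encode-ℕ (proj₁ ∘ even) (λ i → y*2≤ℓ⇒y≤⌊ℓ/2⌋ (subst (_≤ ℓ) (proj₂ (even i)) (h≤ℓ i)))
          λ {y} y< → let i , eq = onto y (y≤⌊ℓ/2⌋⇒y*2≤ℓ y<)
                     in i , ℕ.*-cancelʳ-≡ (proj₁ (even i)) y 2 (trans (sym (proj₂ (even i))) eq)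
    in c , λ i → trans (cong (ℕ._* 2) (eq i)) (sym (proj₂ (even i)))

  encode-odd : ∀ {n ℓ} (h : Fin n → ℕ) → (∀ i → Odd (h i)) → (∀ i → h i ≤ ℓ) →
    (∀ y → y ℕ.* 2 < ℓ → ∃ λ i → h i ≡ suc (y ℕ.* 2)) → ∃ λ (c : Code n ⌈ ℓ /2⌉) → oddLevel c ≗ h
  encode-odd {ℓ = ℓ} h odd h≤ℓ onto =
    let c , eq = encode-ℕ (proj₁ ∘ odd) (λ i → y*2<ℓ⇒y<⌈ℓ/2⌉ (subst (_≤ ℓ) (proj₂ (odd i)) (h≤ℓ i)))
          λ {y} y< → let i , eq = onto y (y<⌈ℓ/2⌉⇒y*2<ℓ y<)
                     in i , ℕ.*-cancelʳ-≡ (proj₁ (odd i)) y 2 (ℕ.suc-injective (trans (sym (proj₂ (odd i))) eq))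
    in c , λ i → trans (cong (λ y → suc (y ℕ.* 2)) (eq i)) (sym (proj₂ (odd i)))

  -- The two summands correspond to the side containing the sinks (the vertices of level 0).
  Layering : (n k ℓ : ℕ) → Set
  Layering n k ℓ = (Code n (suc ⌊ ℓ /2⌋) × Code k ⌈ ℓ /2⌉) ⊎ (Code n ⌈ ℓ /2⌉ × Code k (suc ⌊ ℓ /2⌋))

  Layering↔Fin : ∀ n k ℓ → Layering n k ℓ ↔ Fin (pathCount n k ℓ)
  Layering↔Fin n k ℓ = ↔-sym Fin.+↔⊎ ↔-∘
    ((↔-sym Fin.*↔× ↔-∘ (Code↔Fin n (suc ⌊ ℓ /2⌋) ×-↔ Code↔Fin k ⌈ ℓ /2⌉)) ⊎-↔
     (↔-sym Fin.*↔× ↔-∘ (Code↔Fin n ⌈ ℓ /2⌉ ×-↔ Code↔Fin k (suc ⌊ ℓ /2⌋))))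

  module _ {n k ℓ : ℕ} where

    level : Layering n k ℓ → Vertex n k → ℕ
    level (inj₁ (c , d)) (inj₁ i) = evenLevel c i
    level (inj₁ (c , d)) (inj₂ j) = oddLevel d j
    level (inj₂ (c , d)) (inj₁ i) = oddLevel c i
    level (inj₂ (c , d)) (inj₂ j) = evenLevel d j

    -- A left vertex tells the two summands apart, as its level is even in one and odd in the other;
    -- within a summand the codes are determined by their values.
    level-injective : Fin n → ∀ y y′ → level y ≗ level y′ → y ≡ y′
    level-injective _  (inj₁ (c , d)) (inj₁ (c′ , d′)) eq = cong inj₁ (cong₂ _,_
      (decode-injective c c′ (λ i → Fin.toℕ-injective (ℕ.*-cancelʳ-≡ _ _ 2 (eq (inj₁ i)))))
      (decode-injective d d′ (λ j → Fin.toℕ-injective (ℕ.*-cancelʳ-≡ _ _ 2 (ℕ.suc-injective (eq (inj₂ j)))))))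
    level-injective _  (inj₂ (c , d)) (inj₂ (c′ , d′)) eq = cong inj₂ (cong₂ _,_
      (decode-injective c c′ (λ i → Fin.toℕ-injective (ℕ.*-cancelʳ-≡ _ _ 2 (ℕ.suc-injective (eq (inj₁ i))))))
      (decode-injective d d′ (λ j → Fin.toℕ-injective (ℕ.*-cancelʳ-≡ _ _ 2 (eq (inj₂ j))))))
    level-injective i₀ (inj₁ (c , d)) (inj₂ (c′ , d′)) eq =
      contradiction (eq (inj₁ i₀)) (even≢odd (toℕ (decode c i₀)) (toℕ (decode c′ i₀)))
    level-injective i₀ (inj₂ (c , d)) (inj₁ (c′ , d′)) eq =
      contradiction (sym (eq (inj₁ i₀))) (even≢odd (toℕ (decode c′ i₀)) (toℕ (decode c i₀)))

    level-bounded : ∀ y v → level y v ≤ ℓ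
    level-bounded (inj₁ (c , d)) (inj₁ i) = y≤⌊ℓ/2⌋⇒y*2≤ℓ (Fin.toℕ<n (decode c i))
    level-bounded (inj₁ (c , d)) (inj₂ j) = y<⌈ℓ/2⌉⇒y*2<ℓ (Fin.toℕ<n (decode d j))
    level-bounded (inj₂ (c , d)) (inj₁ i) = y<⌈ℓ/2⌉⇒y*2<ℓ (Fin.toℕ<n (decode c i))
    level-bounded (inj₂ (c , d)) (inj₂ j) = y≤⌊ℓ/2⌋⇒y*2≤ℓ (Fin.toℕ<n (decode d j))

    level-onto : ∀ y {e} → e ≤ ℓ → ∃ λ v → level y v ≡ e
    level-onto y {e} e≤ℓ with even-or-odd e
    level-onto (inj₁ (c , d)) e≤ℓ | inj₁ (x , refl) =
      let i , eq = decode-hits c {x} (y*2≤ℓ⇒y≤⌊ℓ/2⌋ e≤ℓ) in inj₁ i , cong (ℕ._* 2) eq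
    level-onto (inj₁ (c , d)) e≤ℓ | inj₂ (x , refl) =
      let j , eq = decode-hits d {x} (y*2<ℓ⇒y<⌈ℓ/2⌉ e≤ℓ) in inj₂ j , cong (λ y → suc (y ℕ.* 2)) eq
    level-onto (inj₂ (c , d)) e≤ℓ | inj₁ (x , refl) =
      let j , eq = decode-hits d {x} (y*2≤ℓ⇒y≤⌊ℓ/2⌋ e≤ℓ) in inj₂ j , cong (ℕ._* 2) eq
    level-onto (inj₂ (c , d)) e≤ℓ | inj₂ (x , refl) =
      let i , eq = decode-hits c {x} (y*2<ℓ⇒y<⌈ℓ/2⌉ e≤ℓ) in inj₁ i , cong (λ y → suc (y ℕ.* 2)) eq

    level-sides : ∀ y i j → level y (inj₁ i) ≢ level y (inj₂ j)
    level-sides (inj₁ (c , d)) i j eq = even≢odd (toℕ (decode c i)) (toℕ (decode d j)) eq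
    level-sides (inj₂ (c , d)) i j eq = even≢odd (toℕ (decode d j)) (toℕ (decode c i)) (sym eq)

    level-left : ∀ y i i′ → level y (inj₁ i) ≢ suc (level y (inj₁ i′))
    level-left (inj₁ (c , _)) i i′ eq = even≢odd (toℕ (decode c i)) (toℕ (decode c i′)) eq
    level-left (inj₂ (c , _)) i i′ eq = even≢odd (toℕ (decode c i)) (toℕ (decode c i′)) (ℕ.suc-injective eq)

    level-right : ∀ y j j′ → level y (inj₂ j) ≢ suc (level y (inj₂ j′))
    level-right (inj₁ (_ , d)) j j′ eq = even≢odd (toℕ (decode d j)) (toℕ (decode d j′)) (ℕ.suc-injective eq)
    level-right (inj₂ (_ , d)) j j′ eq = even≢odd (toℕ (decode d j)) (toℕ (decode d j′)) eq

  Decreasing : ∀ {n k} → Orientation n k → (Vertex n k → ℕ) → Set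
  Decreasing o h = ∀ {v w} → Arc o v w → h w < h v

  module _ {n k : ℕ} where

    arc-total : ∀ (o : Orientation n k) i j → Arc o (inj₁ i) (inj₂ j) ⊎ Arc o (inj₂ j) (inj₁ i)
    arc-total o i j with direction o i j in eq
    ... | left⇒right = inj₁ (lr eq)
    ... | right⇒left = inj₂ (rl eq)

    direction-injective : ∀ (o o′ : Orientation n k) → (∀ i j → direction o i j ≡ direction o′ i j) → o ≡ o′
    direction-injective o o′ eq = lookup-ext (λ i → lookup-ext (eq i))
      where
      lookup-ext : ∀ {A : Set} {m} {xs ys : Vec A m} → (∀ i → lookup xs i ≡ lookup ys i) → xs ≡ ys
      lookup-ext {xs = xs} {ys} eq = trans (sym (Vec.tabulate∘lookup xs)) (trans (Vec.tabulate-cong eq) (Vec.tabulate∘lookup ys))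

    decreasing-determines : ∀ {h} (o o′ : Orientation n k) → Decreasing o h → Decreasing o′ h → o ≡ o′
    decreasing-determines o o′ dec dec′ = direction-injective o o′ same
      where
      same : ∀ i j → direction o i j ≡ direction o′ i j
      same i j with direction o i j in eq | direction o′ i j in eq′
      ... | left⇒right | left⇒right = refl
      ... | right⇒left | right⇒left = refl
      ... | left⇒right | right⇒left = contradiction (dec (lr eq)) (ℕ.<-asym (dec′ (rl eq′)))
      ... | right⇒left | left⇒right = contradiction (dec (rl eq)) (ℕ.<-asym (dec′ (lr eq′)))

    downward : (h : Vertex n k → ℕ) → Fin n → Fin k → Direction
    downward h i j with h (inj₂ j) ℕ.<? h (inj₁ i)
    ... | yes _ = left⇒right
    ... | no _  = right⇒left

    orientBy : (Vertex n k → ℕ) → Orientation n k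
    orientBy h = tabulate λ i → tabulate λ j → downward h i j

    direction-orientBy : ∀ h i j → direction (orientBy h) i j ≡ downward h i j
    direction-orientBy h i j = trans
      (cong (λ r → lookup r j) (Vec.lookup∘tabulate (λ i → tabulate (downward h i)) i))
      (Vec.lookup∘tabulate (downward h i) j)

    orientBy-decreasing : ∀ {h} → (∀ i j → h (inj₁ i) ≢ h (inj₂ j)) → Decreasing (orientBy h) h
    orientBy-decreasing {h} sides (lr {i} {j} eq) with h (inj₂ j) ℕ.<? h (inj₁ i) | trans (sym (direction-orientBy h i j)) eq
    ... | yes lt | _ = lt
    orientBy-decreasing {h} sides (rl {i} {j} eq) with h (inj₂ j) ℕ.<? h (inj₁ i) | trans (sym (direction-orientBy h i j)) eq
    ... | no ≮   | _ = ℕ.≤∧≢⇒< (ℕ.≮⇒≥ ≮) (sides i j)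

    level-isRanking : ∀ {ℓ} (y : Layering n k ℓ) o → Decreasing o (level y) → IsRanking (Arc o) (level y) ℓ
    level-isRanking y o dec = record
      { bounded    = level-bounded y
      ; onto       = level-onto y
      ; decreasing = dec
      ; successor  = successor
      }
      where
      -- Consecutive levels have opposite parity, so v and w lie on different sides and are joined
      -- by an edge; since o decreases the level, that edge points from v to w.
      step : ∀ v w → level y v ≡ suc (level y w) → Arc o v w
      step (inj₁ i) (inj₁ i′) eq = contradiction eq (level-left y i i′)
      step (inj₂ j) (inj₂ j′) eq = contradiction eq (level-right y j j′)
      step (inj₁ i) (inj₂ j)  eq with arc-total o i j
      ... | inj₁ a = a
      ... | inj₂ a = contradiction (dec a) (ℕ.≤⇒≯ (ℕ.≤-trans (ℕ.n≤1+n _) (ℕ.≤-reflexive (sym eq))))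
      step (inj₂ j) (inj₁ i)  eq with arc-total o i j
      ... | inj₂ a = a
      ... | inj₁ a = contradiction (dec a) (ℕ.≤⇒≯ (ℕ.≤-trans (ℕ.n≤1+n _) (ℕ.≤-reflexive (sym eq))))
      successor : ∀ {v d} → level y v ≡ suc d → ∃ λ w → Arc o v w × level y w ≡ d
      successor {v} {d} eq =
        let w , eq′ = level-onto y (ℕ.≤-trans (ℕ.n≤1+n d) (ℕ.≤-trans (ℕ.≤-reflexive (sym eq)) (level-bounded y v)))
        in w , step v w (trans eq (cong suc (sym eq′))) , eq′

    module _ {o : Orientation n k} {h ℓ} (ranking : IsRanking (Arc o) h ℓ) where
      open IsRanking ranking

      private
        same-level : ∀ i j → h (inj₁ i) ≢ h (inj₂ j)
        same-level i j eq with arc-total o i j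
        ... | inj₁ a = ℕ.<⇒≢ (decreasing a) (sym eq)
        ... | inj₂ a = ℕ.<⇒≢ (decreasing a) eq

        odd-suc : ∀ {d} → Even d → Odd (suc d)
        odd-suc (y , eq) = y , cong suc eq

        even-suc : ∀ {d} → Odd d → Even (suc d)
        even-suc (y , eq) = suc y , cong suc eq

      LeftEven RightEven : Vertex n k → ℕ → Set
      LeftEven (inj₁ _) = Even
      LeftEven (inj₂ _) = Odd
      RightEven (inj₁ _) = Odd
      RightEven (inj₂ _) = Even

      -- Each step to a successor changes the side and lowers the level by one, so parity and side
      -- alternate together. At level 0 all vertices are on the side of the given sink, because an
      -- edge separates the levels of its ends.
      leftEven : ∀ i → h (inj₁ i) ≡ 0 → ∀ d v → h v ≡ d → LeftEven v d
      leftEven i eq₀ zero    (inj₁ _) eq = 0 , refl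
      leftEven i eq₀ zero    (inj₂ j) eq = contradiction (trans eq₀ (sym eq)) (same-level i j)
      leftEven i eq₀ (suc d) v        eq with successor eq
      ... | w , lr _ , eq′ = even-suc (leftEven i eq₀ d w eq′)
      ... | w , rl _ , eq′ = odd-suc (leftEven i eq₀ d w eq′)

      rightEven : ∀ j → h (inj₂ j) ≡ 0 → ∀ d v → h v ≡ d → RightEven v d
      rightEven j eq₀ zero    (inj₂ _) eq = 0 , refl
      rightEven j eq₀ zero    (inj₁ i) eq = contradiction (trans eq (sym eq₀)) (same-level i j)
      rightEven j eq₀ (suc d) v        eq with successor eq
      ... | w , lr _ , eq′ = odd-suc (rightEven j eq₀ d w eq′)
      ... | w , rl _ , eq′ = even-suc (rightEven j eq₀ d w eq′)

      ranking⇒layering : ∃ λ (y : Layering n k ℓ) → level y ≗ h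
      -- The side on which a vertex of level 0 is found selects the summand of `Layering`.
      ranking⇒layering with onto z≤n
      ... | inj₁ i₀ , eq₀ =
        let c , eqᶜ = encode-even (h ∘ inj₁) (λ i → side (inj₁ i)) (bounded ∘ inj₁) onto-even
            d , eqᵈ = encode-odd (h ∘ inj₂) (λ j → side (inj₂ j)) (bounded ∘ inj₂) onto-odd
        in inj₁ (c , d) , λ { (inj₁ i) → eqᶜ i ; (inj₂ j) → eqᵈ j }
        where
        side : ∀ v → LeftEven v (h v)
        side v = leftEven i₀ eq₀ (h v) v refl
        onto-even : ∀ y → y ℕ.* 2 ≤ ℓ → ∃ λ i → h (inj₁ i) ≡ y ℕ.* 2
        onto-even y le with onto le
        ... | inj₁ i , eq = i , eq
        ... | inj₂ j , eq = contradiction (side (inj₂ j)) (even⇒¬odd (y , eq))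
        onto-odd : ∀ y → y ℕ.* 2 < ℓ → ∃ λ j → h (inj₂ j) ≡ suc (y ℕ.* 2)
        onto-odd y lt with onto lt
        ... | inj₂ j , eq = j , eq
        ... | inj₁ i , eq = contradiction (y , eq) (even⇒¬odd (side (inj₁ i)))
      ... | inj₂ j₀ , eq₀ =
        let c , eqᶜ = encode-odd (h ∘ inj₁) (λ i → side (inj₁ i)) (bounded ∘ inj₁) onto-odd
            d , eqᵈ = encode-even (h ∘ inj₂) (λ j → side (inj₂ j)) (bounded ∘ inj₂) onto-even
        in inj₂ (c , d) , λ { (inj₁ i) → eqᶜ i ; (inj₂ j) → eqᵈ j }
        where
        side : ∀ v → RightEven v (h v)
        side v = rightEven j₀ eq₀ (h v) v refl
        onto-even : ∀ y → y ℕ.* 2 ≤ ℓ → ∃ λ j → h (inj₂ j) ≡ y ℕ.* 2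
        onto-even y le with onto le
        ... | inj₂ j , eq = j , eq
        ... | inj₁ i , eq = contradiction (side (inj₁ i)) (even⇒¬odd (y , eq))
        onto-odd : ∀ y → y ℕ.* 2 < ℓ → ∃ λ i → h (inj₁ i) ≡ suc (y ℕ.* 2)
        onto-odd y lt with onto lt
        ... | inj₁ i , eq = i , eq
        ... | inj₂ j , eq = contradiction (y , eq) (even⇒¬odd (side (inj₂ j)))

    anyVertex? : ∀ {P : Vertex n k → Set} → Unary.Decidable P → Dec (∃ P)
    anyVertex? P? = map′
      (λ { (inj₁ (i , p)) → inj₁ i , p ; (inj₂ (j , p)) → inj₂ j , p })
      (λ { (inj₁ i , p) → inj₁ (i , p) ; (inj₂ j , p) → inj₂ (j , p) })
      (Fin.any? (P? ∘ inj₁) ⊎-dec Fin.any? (P? ∘ inj₂))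

    arc? : ∀ (o : Orientation n k) v w → Dec (Arc o v w)
    arc? o (inj₁ i) (inj₁ _) = no λ ()
    arc? o (inj₂ j) (inj₂ _) = no λ ()
    arc? o (inj₁ i) (inj₂ j) with direction o i j in eq
    ... | left⇒right = yes (lr eq)
    ... | right⇒left = no λ { (lr eq′) → contradiction (trans (sym eq) eq′) λ () }
    arc? o (inj₂ j) (inj₁ i) with direction o i j in eq
    ... | right⇒left = yes (rl eq)
    ... | left⇒right = no λ { (rl eq′) → contradiction (trans (sym eq) eq′) λ () }

    walk? : ∀ (o : Orientation n k) d → Unary.Decidable (Walk (Arc o) d)
    walk? o zero    v = yes tt
    walk? o (suc d) v = anyVertex? λ w → arc? o v w ×-dec walk? o d w

  -- Enumeration of the acyclic orientations

  vectors-unique : ∀ {A : Set} {as : List A} → Unique as → ∀ m → Unique (vectors as m)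
  vectors-unique u zero    = ListAll.[] ∷ []
  vectors-unique u (suc m) = Unique.cartesianProductWith⁺ _∷_ Vec.∷-injective u (vectors-unique u m)

  ∈-vectors : ∀ {A : Set} {as : List A} → (∀ a → a ∈ as) → ∀ {m} (v : Vec A m) → v ∈ vectors as m
  ∈-vectors all []      = here refl
  ∈-vectors all (a ∷ v) = ∈-cartesianProductWith⁺ _∷_ (all a) (∈-vectors all v)

  orientations-unique : ∀ n k → Unique (orientations n k)
  orientations-unique n k = vectors-unique (vectors-unique (((λ ()) ListAll.∷ ListAll.[]) ∷ (ListAll.[] ∷ [])) k) n

  ∈-orientations : ∀ {n k} (o : Orientation n k) → o ∈ orientations n k
  ∈-orientations = ∈-vectors (∈-vectors λ { left⇒right → here refl ; right⇒left → there (here refl) })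

  -- An orientation is related to a layering when all its arcs go down in level. Its rank function
  -- yields a layering, and conversely a layering orients every edge downwards. The levels fix each
  -- direction, and uniqueness of rankings fixes the levels.
  count : ∀ n k → Fin n → ∀ ℓ → length (filter (longestPathHasLength? ℓ) (acyclicOrientations n k)) ≡ pathCount n k ℓ
  count n k i₀ ℓ = length-≡ (λ o y → Decreasing o (level y))
    (Unique.filter⁺ (longestPathHasLength? ℓ) (Unique.filter⁺ acyclic? (orientations-unique n k)))
    (Layering↔Fin n k ℓ)
    (λ {o} o∈ →
      let o∈acyclic , longest = ∈-filter⁻ (longestPathHasLength? ℓ) {xs = acyclicOrientations n k} o∈
          _ , acyclic = ∈-filter⁻ acyclic? {xs = orientations n k} o∈acyclic
          ranking = rank-isRanking (Arc o) (walk? o) acyclic (path-length-< o) longest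
          y , eq = ranking⇒layering ranking
      in y , λ {v} {w} a → subst₂ _<_ (sym (eq w)) (sym (eq v)) (IsRanking.decreasing ranking a))
    (λ y →
      let o = orientBy (level y)
          dec = orientBy-decreasing (level-sides y)
      in o , ∈-filter⁺ (longestPathHasLength? ℓ) (∈-filter⁺ acyclic? (∈-orientations o) (decreasing⇒acyclic (Arc o) dec))
               (ranking⇒longest (Arc o) (level-isRanking y o dec)) , dec)
    (λ {o} {o′} → decreasing-determines o o′)
    (λ {o} {y} {y′} dec dec′ → level-injective i₀ y y′
      (ranking-unique (Arc o) (level-isRanking y o dec) (level-isRanking y′ o dec′)))

  -- The orientations are sorted by their longest path, whose length is below n + k. The bound b is
  -- left free because the coefficient at u = 1 arrives as a longer sum.
  total : ∀ n k → Fin n → ∀ {b} → n ℕ.+ k ≤ b → length (acyclicOrientations n k) ≡ ℕ.sum (applyUpTo (pathCount n k) b)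
  total n k i₀ {b} n+k≤b = trans
    (length-partition longestPathHasLength? (λ {o} → longest-unique (Arc o)) b (acyclicOrientations n k) λ {o} o∈ →
      let ℓ , longest , ℓ< = longest-exists (Arc o) (walk? o) (proj₂ (∈-filter⁻ acyclic? {xs = orientations n k} o∈))
            (path-length-< o) (λ d → anyVertex? (walk? o d)) (inj₁ i₀)
      in ℓ , longest , ℕ.≤-trans ℓ< n+k≤b)
    (sum-applyUpTo-cong b (count n k i₀))

open Orientations using (count; total)

corollary1p1 : (n k : ℕ) {{_ : NonZero n}} {{_ : NonZero k}} →
  Σ[ nz ∈ ℚ.NonZero (coeffF₁ n k) ]
    pgf n k ≈ₚ (ℚ.1/ coeffF₁ n k) {{nz}} • coeffF n k
corollary1p1 n k = nz , λ ℓ → begin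
  coeff (pgf n k) ℓ
    ≡⟨ coeff-pgf n k ℓ ⟩
  probLongestPath n k ℓ
    ≡⟨ ratio (length (filter (longestPathHasLength? ℓ) (acyclicOrientations n k))) (length (acyclicOrientations n k))
         {{acyclicOrientations-nonEmpty n k}} w {{nz}} F₁≡ ⟩
  F₁⁻¹ * (fromℕ (length (filter (longestPathHasLength? ℓ) (acyclicOrientations n k))) * w)
    ≡⟨ cong (λ c → F₁⁻¹ * (fromℕ c * w)) (count n k i₀ ℓ) ⟩
  F₁⁻¹ * pathWeight n k ℓ
    ≡⟨ cong (F₁⁻¹ *_) (coeff-coeffF n k 0≢n+k ℓ) ⟨
  F₁⁻¹ * coeff (coeffF n k) ℓ
    ≡⟨ coeff-• F₁⁻¹ (coeffF n k) ℓ ⟨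
  coeff (F₁⁻¹ • coeffF n k) ℓ ∎
  where
  open ≡.≡-Reasoning
  open ≡ using (sym; trans; cong)
  open import Data.Rational.Base using (_*_)
  i₀ : Fin n
  i₀ = fromℕ< (ℕ.>-nonZero⁻¹ n)
  0≢n+k : 0 ≢ n ℕ.+ k
  0≢n+k = ℕ.≢-nonZero⁻¹ n ∘ ℕ.m+n≡0⇒m≡0 n ∘ sym
  n+k≤2[1+n+k] : n ℕ.+ k ≤ suc (n ℕ.+ k) ℕ.* 2
  n+k≤2[1+n+k] = ℕ.≤-trans (ℕ.n≤1+n _) (ℕ.m≤m*n (suc (n ℕ.+ k)) 2)
  w : ℚ
  w = 1/ n ! * 1/ k !
  -- At u = 1 all lengths are added up, so the denominator is the number of acyclic orientations
  -- with the weight w; as there is at least one, it is nonzero.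
  F₁≡ : coeffF₁ n k ≡ fromℕ (length (acyclicOrientations n k)) * w
  F₁≡ = trans (coeffF₁-total n k 0≢n+k) (cong (λ c → fromℕ c * w) (sym (total n k i₀ n+k≤2[1+n+k])))
  nz : ℚ.NonZero (coeffF₁ n k)
  nz = ℚ.≢-nonZero λ F₁≡0 → weighted≢0 n k (length (acyclicOrientations n k))
    {{acyclicOrientations-nonEmpty n k}} (trans (sym F₁≡) F₁≡0)
  F₁⁻¹ = (ℚ.1/ coeffF₁ n k) {{nz}}
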